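{- Let $X\subset\mathbb{R}$ be a finite set with $d(x,y)=|x-y|$ and let $s_0\in X$ be the initial server position. The global-hull algorithm has a $10$-competitive automatic-service implementation for visible online service on $X$: its automatic implementation (defined in the context) satisfies $\operatorname{ALG}(I)\le 10\operatorname{OPT}_{\mathrm{auto}}(I)$ for every finite input $I$, where $\operatorname{OPT}_{\mathrm{auto}}(I)$ is the offline optimum under automatic service.
   Context: Model. $(X,d)$ is a finite metric space and $s_0\in X$ is the initial server position. An input $I$ is a finite set of request occurrences; each request $q$ has an arrival time $a(q)\ge 0$ and a location $x(q)\in X$. An arrival epoch is the set of all requests sharing one arrival time. A walk $P=(v_0,\ldots,v_\ell)$ in $X$ ($\ell\ge 0$) is executed instantaneously at one time, visits its listed vertices, and has length $\operatorname{len}(P)=\sum_{i}d(v_{i-1},v_i)$; on the line, a monotone move lists all sites in between. A schedule is a finite sequence of atomic actions with nondecreasing timestamps. At time $t$ the complete epoch arriving at $t$ is processed first; then one action at $t$ performs a finite ordered sequence of walks, and no further arrival is processed until the action ends. The first walk starts at $s_0$ and every later one starts where its predecessor ended. A walk $P$ at time $t$ during which a nonempty set $B$ of pending requests is served is one service event of cost $\operatorname{len}(P)+\max_{q\in B}(t-a(q))$; a walk serving no request costs $\operatorname{len}(P)$. The cost of a schedule is the sum of these costs. Every request must eventually be served. Automatic service: every pending request whose location is visited by a walk is served in that event (so a nominally pure movement becomes a service event if it visits a pending request), and a request arriving at the current server position is served immediately (at zero cost). $\operatorname{OPT}_{\mathrm{auto}}(I)$ is the infimum of the cost over all feasible (clairvoyant)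 automatic-service schedules. Visible: the location of a request is revealed at its arrival. Automatic implementation of the global-hull algorithm. It works in phases. Maintain the current server position $e$ (initially $s_0$) and the previous hull $H_{\mathrm{prev}}$ (initially $\{s_0\}$). Between phases the server is parked at $e$; an epoch arriving while idle that consists only of requests located at $e$ is served at once at zero cost and does not form a phase. A phase starts with the first other epoch; its virtual set $V$ consists of all requests of that epoch and all requests arriving afterwards until the phase ends, where requests that are automatically served at the parked position $e$ are retained in $V$ as virtual ghosts with their original arrival time and location. Let $\alpha=\min_{q\in V}a(q)$. At each time $t$ let $H(t)=[L,R]$ be the interval hull of the locations of members of $V$ that have arrived by $t$, and $b(t)=\operatorname{diam}(H(t))+\operatorname{dist}(H_{\mathrm{prev}},H(t))$. The algorithm triggers at the first time $t$ (tested after processing the complete epoch at $t$) with $t-\alpha\ge b(t)$. It then walks, in one component, from $e$ to the nearer endpoint of $H(t)$ (to $L$ if $|e-L|\le|e-R|$, otherwise to $R$) and then to the opposite endpoint, automatically serving every remaining real request, sets $e$ to the final endpoint and $H_{\mathrm{prev}}$ to $H(t)$, deletes all ghosts, and ends the phase. -}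

module Defs where

open import Algebra.Bundles using (CommutativeRing)
open import Algebra.Structures using (IsCommutativeRing)
import Algebra.Construct.NaturalChoice.Max as Max
import Algebra.Definitions.RawMonoid as Mult
open import Data.Fin.Base as Fin using (Fin)
import Data.Fin.Properties as Fin
open import Data.List.Base
  using (List; []; _∷_; [_]; _++_; map; concatMap; filter; foldr; reverse; allFin)
import Data.List.Extrema as Extrema
import Data.List.Membership.DecPropositional as DecMembership
open import Data.List.Membership.Propositional using (_∈_)
open import Data.List.NonEmpty.Base using (List⁺; _∷_; toList; head)
open import Data.List.Relation.Unary.All using (All)
open import Data.List.Relation.Unary.Linked using (Linked)
open import Data.Nat.Base using (ℕ)
open import Data.Product.Base using (∃; _×_)
open import Data.Unit.Base using (⊤)
open import Relation.Binary.Bundles using (DecTotalOrder)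
open import Relation.Binary.Structures using (IsDecTotalOrder)
import Relation.Binary.Construct.NonStrictToStrict as NonStrictToStrict
open import Relation.Binary.PropositionalEquality.Core using (_≡_; _≢_)
open import Relation.Nullary.Decidable using (Dec; yes; no; ¬?; _×-dec_)
open import Relation.Nullary.Negation using (¬_)

module _ {A : Set} (_≤_ : A → A → Set) where

  IsLowerBound : (A → Set) → A → Set
  IsLowerBound P l = ∀ x → P x → l ≤ x

  record IsInfimum (P : A → Set) (i : A) : Set where
    field
      lowerBound : IsLowerBound P i
      greatest   : ∀ l → IsLowerBound P l → l ≤ i

  record IsLeast (P : A → Set) (m : A) : Set where
    field
      holds      : P m
      lowerBound : IsLowerBound P m

-- The real numbers, axiomatised as a Dedekind-complete ordered field. The order
-- is decidable, as it is classically; the algorithm branches on comparisons.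
record Reals : Set₁ where
  infix  8 -_
  infixl 7 _*_
  infixl 6 _+_ _-_
  infix  4 _≤_
  field
    ℝ       : Set
    _≤_     : ℝ → ℝ → Set
    _+_ _*_ : ℝ → ℝ → ℝ
    -_      : ℝ → ℝ
    0# 1#   : ℝ
    isCommutativeRing : IsCommutativeRing _≡_ _+_ _*_ -_ 0# 1#
    0≢1               : 0# ≢ 1#
    inverse           : ∀ x → x ≢ 0# → ∃ λ y → x * y ≡ 1#
    isDecTotalOrder   : IsDecTotalOrder _≡_ _≤_
    +-monoˡ-≤         : ∀ z {x y} → x ≤ y → x + z ≤ y + z
    *-nonNeg          : ∀ {x y} → 0# ≤ x → 0# ≤ y → 0# ≤ x * y
    complete          : (P : ℝ → Set) → ∃ P → ∃ (IsLowerBound _≤_ P) →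
                        ∃ (IsInfimum _≤_ P)

  commutativeRing : CommutativeRing _ _
  commutativeRing = record { isCommutativeRing = isCommutativeRing }

  decTotalOrder : DecTotalOrder _ _ _
  decTotalOrder = record { isDecTotalOrder = isDecTotalOrder }

  open IsDecTotalOrder isDecTotalOrder public using (_≤?_)
  open NonStrictToStrict _≡_ _≤_ public using (_<_)
  open Max (DecTotalOrder.totalOrder decTotalOrder) public using (_⊔_)

  _-_ : ℝ → ℝ → ℝ
  x - y = x + - y

  ∣_∣ : ℝ → ℝ
  ∣ x ∣ = x ⊔ - x

  -- n · x is the n-fold sum x + ⋯ + x.
  infixr 8 _·_
  _·_ : ℕ → ℝ → ℝ
  _·_ = Mult._×_ (CommutativeRing.+-rawMonoid commutativeRing)

-- A finite subset of ℝ, given by its increasing enumeration. Sites are the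
-- indices, so the order on Fin size is the order of the sites along the line.
record FiniteSubset (𝓡 : Reals) : Set where
  open Reals 𝓡
  field
    size       : ℕ
    coord      : Fin size → ℝ
    increasing : ∀ {i j} → i Fin.< j → coord i < coord j

module Service (𝓡 : Reals) (X : FiniteSubset 𝓡) where

  open Reals 𝓡 public
  open FiniteSubset X public

  Site : Set
  Site = Fin size

  open DecMembership (Fin._≟_ {size}) using (_∈?_)

  d : Site → Site → ℝ
  d u v = ∣ coord u - coord v ∣

  record Request : Set where
    field
      arrival   : ℝ
      arrival≥0 : 0# ≤ arrival
      location  : Site
  open Request public

  -- A multiset of request occurrences; the order of the list plays no role.
  Input : Set
  Input = List Request

  Walk : Set
  Walk = List⁺ Site

  lenFrom : Site → List Site → ℝ
  lenFrom v []       = 0#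
  lenFrom v (w ∷ vs) = d v w + lenFrom w vs

  len : Walk → ℝ
  len (v ∷ vs) = lenFrom v vs

  endFrom : Site → List Site → Site
  endFrom v []       = v
  endFrom v (w ∷ vs) = endFrom w vs

  end : Walk → Site
  end (v ∷ vs) = endFrom v vs

  Between : Site → Site → Site → Set
  Between u v z = (u Fin.< z) × (z Fin.< v)

  -- On the line a move lists all sites in between, so a step of a walk
  -- cannot jump over a site.
  Step : Site → Site → Set
  Step u v = ∀ z → ¬ Between u v z × ¬ Between v u z

  record Action : Set where
    constructor _at_
    field
      walks : List Walk
      time  : ℝ
  open Action public

  Schedule : Set
  Schedule = List Action

  ----------------------------------------------------------------------
  -- Automatic service

  record State : Set where
    constructor ⟨_,_,_⟩
    field
      position : Site
      pending  : List Request
      upcoming : List Request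
  open State public

  initial : Site → Input → State
  initial s₀ I = ⟨ s₀ , [] , I ⟩

  elsewhere : Site → List Request → List Request
  elsewhere v = filter (λ q → ¬? (location q Fin.≟ v))

  after : ℝ → List Request → List Request
  after t = filter (λ q → ¬? (arrival q ≤? t))

  -- All epochs up to and including time t arrive while the server is parked;
  -- requests at its position are served at zero cost.
  arrive : ℝ → State → State
  arrive t ⟨ v , pend , up ⟩ =
    ⟨ v , pend ++ elsewhere v (filter (λ q → arrival q ≤? t) up) , after t up ⟩

  served : Walk → List Request → List Request
  served P = filter (λ q → location q ∈? toList P)

  -- Zero on the empty list; otherwise the maximum, since served requests
  -- have arrived and hence have nonnegative delay.
  maxDelay : ℝ → List Request → ℝ
  maxDelay t = foldr (λ q m → (t - arrival q) ⊔ m) 0#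

  walkCost : ℝ → Walk → State → ℝ
  walkCost t P st = len P + maxDelay t (served P (pending st))

  afterWalk : Walk → State → State
  afterWalk P ⟨ _ , pend , up ⟩ =
    ⟨ end P , filter (λ q → ¬? (location q ∈? toList P)) pend , up ⟩

  walksCost : ℝ → List Walk → State → ℝ
  walksCost t []       st = 0#
  walksCost t (P ∷ Ps) st = walkCost t P st + walksCost t Ps (afterWalk P st)

  afterWalks : List Walk → State → State
  afterWalks []       st = st
  afterWalks (P ∷ Ps) st = afterWalks Ps (afterWalk P st)

  costFrom : State → Schedule → ℝ
  costFrom st []             = 0#
  costFrom st ((Ps at t) ∷ S) =
    let st′ = arrive t st in walksCost t Ps st′ + costFrom (afterWalks Ps st′) S

  finalFrom : State → Schedule → State
  finalFrom st []             = st
  finalFrom st ((Ps at t) ∷ S) = finalFrom (afterWalks Ps (arrive t st)) S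

  Chained : Site → List Walk → Set
  Chained v []       = ⊤
  Chained v (P ∷ Ps) = head P ≡ v × Chained (end P) Ps

  cost : Site → Input → Schedule → ℝ
  cost s₀ I = costFrom (initial s₀ I)

  record Feasible (s₀ : Site) (I : Input) (S : Schedule) : Set where
    field
      ordered     : Linked _≤_ (map time S)
      chained     : Chained s₀ (concatMap walks S)
      contiguous  : All (λ P → Linked Step (toList P)) (concatMap walks S)
      -- Requests arriving after the last action are served exactly when
      -- they are located at the final position.
      nonePending : pending (finalFrom (initial s₀ I) S) ≡ []
      noneMissed  : let st = finalFrom (initial s₀ I) S in
                    All (λ q → location q ≡ position st) (upcoming st)

  FeasibleCost : Site → Input → ℝ → Set
  FeasibleCost s₀ I c = ∃ λ S → Feasible s₀ I S × cost s₀ I S ≡ c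

  IsOPT : Site → Input → ℝ → Set
  IsOPT s₀ I = IsInfimum _≤_ (FeasibleCost s₀ I)

  ----------------------------------------------------------------------
  -- The global-hull algorithm

  record Interval : Set where
    constructor [_,_]ᴵ
    field
      left right : Site
  open Interval public

  diam : Interval → ℝ
  diam [ l , r ]ᴵ = coord r - coord l

  -- The gap between two intervals, and zero if they intersect.
  dist : Interval → Interval → ℝ
  dist [ l , r ]ᴵ [ l′ , r′ ]ᴵ =
    0# ⊔ (coord l′ - coord r) ⊔ (coord l - coord r′)

  near far : Site → Interval → Site
  near e [ l , r ]ᴵ with d e l ≤? d e r
  ... | yes _ = l
  ... | no  _ = r
  far e [ l , r ]ᴵ with d e l ≤? d e r
  ... | yes _ = r
  ... | no  _ = l

  -- The sites met on the way from u to v, in order, without u; one of the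
  -- two lists is empty.
  moves : Site → Site → List Site
  moves u v =
       filter (λ z → (u Fin.<? z) ×-dec (z Fin.≤? v)) (allFin size)
    ++ reverse (filter (λ z → (v Fin.≤? z) ×-dec (z Fin.<? u)) (allFin size))

  sweep : Site → Interval → Walk
  sweep e H = e ∷ (moves e (near e H) ++ moves (near e H) (far e H))

  -- A phase: H₀ is the previous hull, R the requests arriving after the
  -- previous phase, and q₀ a member of R whose arrival starts the phase.
  module Phase (H₀ : Interval) (R : List Request) (q₀ : Request) where

    α : ℝ
    α = arrival q₀

    -- The members of the virtual set arrived by time t, ghosts included.
    -- Their earliest arrival time is α, as q₀ is one of them.
    V : ℝ → List Request
    V t = filter (λ q → (α ≤? arrival q) ×-dec (arrival q ≤? t)) R

    -- location q₀ is only a default for the empty list: q₀ ∈ V t if α ≤ t.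
    H : ℝ → Interval
    H t = [ min (location q₀) (map location (V t))
          , max (location q₀) (map location (V t)) ]ᴵ
      where open Extrema (Fin.≤-totalOrder size) using (min; max)

    b : ℝ → ℝ
    b t = diam (H t) + dist H₀ (H t)

    Triggers : ℝ → Set
    Triggers t = α ≤ t × b t ≤ t - α

  -- Run e H₀ R S: with the server parked at e, previous hull H₀ and R still
  -- to arrive, the algorithm performs the actions S. The next phase starts
  -- with the first epoch containing a request not located at e.
  data Run (e : Site) (H₀ : Interval) (R : List Request) : Schedule → Set where
    idle  : All (λ q → location q ≡ e) R → Run e H₀ R []
    phase : ∀ {q₀ t S} →
            let open Phase H₀ R q₀ in
            q₀ ∈ R → location q₀ ≢ e →
            (∀ q → q ∈ R → location q ≢ e → arrival q₀ ≤ arrival q) →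
            IsLeast _≤_ Triggers t →
            Run (far e (H t)) (H t) (after t R) S →
            Run e H₀ R (([ sweep e (H t) ] at t) ∷ S)

  GlobalHullRun : Site → Input → Schedule → Set
  GlobalHullRun s₀ I = Run s₀ [ s₀ , s₀ ]ᴵ I

{-# OPTIONS --safe #-}
module Submission where

-- Let phase i start at αᵢ and trigger at tᵢ, and put Tᵢ = tᵢ - αᵢ. Since the trigger rule gives
-- diam Hᵢ + dist Hᵢ₋₁ Hᵢ ≤ Tᵢ and the server starts the phase inside Hᵢ₋₁, the phase costs at most
-- diam Hᵢ₋₁ - diam Hᵢ + 4 Tᵢ, so the algorithm pays at most 4 ∑ Tᵢ in total.
--
-- An offline schedule pays at least Tᵢ between tᵢ₋₂ and tᵢ, waiting being charged as it accrues.
-- Its payment Y grows at unit rate while requests are pending. Whenever none are, it has visited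
-- every location requested so far by phases i - 1 and i, so that the hull of phase i has b ≤ Y and
-- the algorithm would trigger by time αᵢ + Y. As each moment lies in two of these windows,
-- ∑ Tᵢ ≤ 2 OPT, and the ratio is in fact at most 8.

open import Algebra.Bundles using (CommutativeRing)
import Algebra.Construct.NaturalChoice.Max as Max
import Algebra.Properties.AbelianGroup as AbelianGroupProperties
import Algebra.Properties.Ring as RingProperties
import Algebra.Properties.Semiring.Mult as SemiringMult
import Algebra.Solver.Ring as RingSolver
open import Algebra.Solver.Ring.AlmostCommutativeRing
  using (_-Raw-AlmostCommutative⟶_; fromCommutativeRing)
import Data.Fin.Base as Fin
import Data.Fin.Properties as Fin
open import Data.Integer.Base as ℤ using (ℤ; 0ℤ; _⊖_)
import Data.Integer.Properties as ℤ
open import Data.List.Base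
  using (List; []; _∷_; [_]; _++_; map; concatMap; filter; reverse; allFin; length)
import Data.List.Extrema as Extrema
import Data.List.Membership.DecPropositional as DecMembership
open import Data.List.Membership.Propositional using (_∈_; find; lose)
open import Data.List.Membership.Propositional.Properties
  using (∈-filter⁺; ∈-filter⁻; ∈-allFin; ∈-++⁺ˡ; ∈-++⁺ʳ; ∈-++⁻; ∈-map⁺; ∈-map⁻)
open import Data.List.NonEmpty.Base using (toList; head; _∷_)
open import Data.List.Properties
  using (filter-none; filter-notAll; filter-accept; filter-reject; ++-identityʳ; unfold-reverse)
open import Data.List.Relation.Unary.All as All using (All; []; _∷_)
import Data.List.Relation.Unary.All.Properties as All
open import Data.List.Relation.Unary.AllPairs using (AllPairs; []; _∷_)
import Data.List.Relation.Unary.AllPairs.Properties as AllPairs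
open import Data.List.Relation.Unary.Any using (here; there)
import Data.List.Relation.Unary.Any.Properties as Any
open import Data.List.Relation.Unary.Linked as Linked using (Linked; [-]; _∷_)
import Data.Maybe.Base as Maybe
open import Data.Nat.Base as ℕ using (zero; suc)
import Data.Nat.Properties as ℕ
open import Data.Product.Base using (∃; _×_; _,_; proj₁; proj₂)
open import Data.Sum.Base using (_⊎_; inj₁; inj₂)
open import Data.Unit.Base using (tt)
open import Function.Base using (_∘_; flip; id)
open import Level using (0ℓ)
open import Relation.Binary.Bundles using (DecTotalOrder)
open import Relation.Binary.Core using (Rel)
open import Relation.Binary.PropositionalEquality
  using (_≡_; _≢_; refl; sym; trans; cong; cong₂; subst; subst₂; module ≡-Reasoning)
open import Relation.Nullary.Decidable
  using (Dec; yes; no; ¬?; _×-dec_; dec⇒maybe; decidable-stable)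
open import Relation.Nullary.Negation using (¬_; contradiction)
open import Relation.Unary using (Pred; Decidable)
open import Defs

-- The trigger bound contains the distance to the previous hull, so a payment of `Y` decides phase i
-- only if the offline server is known to have visited that hull too. Its endpoints were requested
-- by `tᵢ₋₁`, and the offline server may have served them before then. A window that opens at `tᵢ₋₂`
-- still has all of them ahead; this is where the factor 2 comes from.
--
-- Delay is charged as a maximum per service event, and only at service, so the cost of a schedule
-- does not split over windows by itself. A potential repairs this: the largest delay among the
-- pending requests counts as already paid. A walk lowers it by at most the delay that the walk is
-- charged, so payments are nonnegative and add up over consecutive windows.
--
-- Automatic service can remove a request at its arrival for free, but only at the server's
-- position, which counts as visited. Hence the location of a request is visited, or the request is
-- pending or still to come; this is carried through each window.
--
-- The optimum is an infimum, so the bound is proved against every feasible schedule. That a first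
-- trigger time and a run exist is proved as well.

AllPairs-reverse : ∀ {A : Set} {R : Rel A 0ℓ} {xs} →
                   AllPairs (flip R) xs → AllPairs R (reverse xs)
AllPairs-reverse [] = []
AllPairs-reverse {R = R} {x ∷ xs} (Rxs ∷ rest) = subst (AllPairs R) (sym (unfold-reverse x xs))
  (AllPairs.++⁺ (AllPairs-reverse rest) ([] ∷ [])
    (All.tabulate (λ y∈ → All.lookup Rxs (Any.reverse⁻ y∈) ∷ [])))

filter-cong : ∀ {A : Set} {P Q : Pred A 0ℓ} (P? : Decidable P) (Q? : Decidable Q) xs →
              (∀ {x} → x ∈ xs → P x → Q x) → (∀ {x} → x ∈ xs → Q x → P x) →
              filter P? xs ≡ filter Q? xs
filter-cong P? Q? [] _ _ = refl
filter-cong P? Q? (x ∷ xs) P⇒Q Q⇒P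
  with ih ← filter-cong P? Q? xs (P⇒Q ∘ there) (Q⇒P ∘ there) | P? x
... | yes p = trans (cong (x ∷_) ih) (sym (filter-accept Q? (P⇒Q (here refl) p)))
... | no ¬p = trans ih (sym (filter-reject Q? (¬p ∘ Q⇒P (here refl))))

-- Ordered field arithmetic

module OrderedField (𝓡 : Reals) where

  open Reals 𝓡
  private module R = CommutativeRing commutativeRing
  open RingProperties R.ring using (-0#≈0#; -‿distribˡ-*; -‿distribʳ-*; -‿involutive)
  open AbelianGroupProperties R.+-abelianGroup using (⁻¹-∙-comm)
  open SemiringMult R.semiring using (×-homo-+; ×1-homo-*; ×-comm-*)

  module ≤ = DecTotalOrder decTotalOrder
  open Max ≤.totalOrder public
    using (x≤x⊔y; x≤y⊔x; ⊔-lub)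

  -- The ring solver needs coefficients that compute. Elements of the axiomatised `ℝ` do not reduce,
  -- so integers are used, interpreted by their canonical image.
  module IntegerCoefficients where

    ⟦_⟧ : ℤ → ℝ
    ⟦ ℤ.+ n      ⟧ = n · 1#
    ⟦ ℤ.-[1+ n ] ⟧ = - (suc n · 1#)

    -‿homo : ∀ i → ⟦ ℤ.- i ⟧ ≡ - ⟦ i ⟧
    -‿homo (ℤ.+ zero)  = sym -0#≈0#
    -‿homo (ℤ.+ suc n) = refl
    -‿homo ℤ.-[1+ n ]  = sym (-‿involutive _)

    ⊖-homo : ∀ m n → ⟦ m ⊖ n ⟧ ≡ m · 1# - n · 1#
    ⊖-homo m       zero    = trans (sym (R.+-identityʳ _)) (cong ((m · 1#) +_) (sym -0#≈0#))
    ⊖-homo zero    (suc n) = sym (R.+-identityˡ _)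
    ⊖-homo (suc m) (suc n) = begin
      ⟦ suc m ⊖ suc n ⟧                ≡⟨ cong ⟦_⟧ (ℤ.[1+m]⊖[1+n]≡m⊖n m n) ⟩
      ⟦ m ⊖ n ⟧                        ≡⟨ ⊖-homo m n ⟩
      m · 1# - n · 1#                  ≡⟨ cong (_- n · 1#) (sym (R.+-identityʳ _)) ⟩
      (m · 1# + 0#) - n · 1#           ≡⟨ cong (λ z → (m · 1# + z) - n · 1#) (sym (R.-‿inverseʳ 1#)) ⟩
      (m · 1# + (1# - 1#)) - n · 1#    ≡⟨ cong (_- n · 1#) (sym (R.+-assoc _ _ _)) ⟩
      ((m · 1# + 1#) - 1#) - n · 1#    ≡⟨ R.+-assoc _ _ _ ⟩
      (m · 1# + 1#) + (- 1# - n · 1#)  ≡⟨ cong₂ _+_ (R.+-comm _ _) (⁻¹-∙-comm _ _) ⟩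
      (1# + m · 1#) - (1# + n · 1#)    ∎
      where open ≡-Reasoning

    +-homo : ∀ i j → ⟦ i ℤ.+ j ⟧ ≡ ⟦ i ⟧ + ⟦ j ⟧
    +-homo (ℤ.+ m)    (ℤ.+ n)    = ×-homo-+ 1# m n
    +-homo (ℤ.+ m)    ℤ.-[1+ n ] = ⊖-homo m (suc n)
    +-homo ℤ.-[1+ m ] (ℤ.+ n)    = trans (⊖-homo n (suc m)) (R.+-comm _ _)
    +-homo ℤ.-[1+ m ] ℤ.-[1+ n ] = begin
      - (suc (suc (m ℕ.+ n)) · 1#)  ≡⟨ cong (λ k → - (suc k · 1#)) (sym (ℕ.+-suc m n)) ⟩
      - ((suc m ℕ.+ suc n) · 1#)    ≡⟨ cong -_ (×-homo-+ 1# (suc m) (suc n)) ⟩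
      - (suc m · 1# + suc n · 1#)   ≡⟨ sym (⁻¹-∙-comm _ _) ⟩
      - (suc m · 1#) - suc n · 1#   ∎
      where open ≡-Reasoning

    *-homo : ∀ i j → ⟦ i ℤ.* j ⟧ ≡ ⟦ i ⟧ * ⟦ j ⟧
    *-homo (ℤ.+ m) (ℤ.+ n) =
      trans (cong ⟦_⟧ (ℤ.+◃n≡+n (m ℕ.* n))) (×1-homo-* m n)
    *-homo (ℤ.+ m) ℤ.-[1+ n ] = begin
      ⟦ ℤ.+ m ℤ.* ℤ.-[1+ n ] ⟧   ≡⟨ cong ⟦_⟧ (ℤ.-◃n≡-n (m ℕ.* suc n)) ⟩
      ⟦ ℤ.- ℤ.+ (m ℕ.* suc n) ⟧  ≡⟨ -‿homo (ℤ.+ (m ℕ.* suc n)) ⟩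
      - ((m ℕ.* suc n) · 1#)     ≡⟨ cong -_ (×1-homo-* m (suc n)) ⟩
      - (m · 1# * (suc n · 1#))  ≡⟨ -‿distribʳ-* _ _ ⟩
      m · 1# * - (suc n · 1#)    ∎
      where open ≡-Reasoning
    *-homo ℤ.-[1+ m ] (ℤ.+ n) = begin
      ⟦ ℤ.-[1+ m ] ℤ.* ℤ.+ n ⟧   ≡⟨ cong ⟦_⟧ (ℤ.-◃n≡-n (suc m ℕ.* n)) ⟩
      ⟦ ℤ.- ℤ.+ (suc m ℕ.* n) ⟧  ≡⟨ -‿homo (ℤ.+ (suc m ℕ.* n)) ⟩
      - ((suc m ℕ.* n) · 1#)     ≡⟨ cong -_ (×1-homo-* (suc m) n) ⟩
      - (suc m · 1# * (n · 1#))  ≡⟨ -‿distribˡ-* _ _ ⟩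
      - (suc m · 1#) * (n · 1#)  ∎
      where open ≡-Reasoning
    *-homo ℤ.-[1+ m ] ℤ.-[1+ n ] = begin
      (suc m ℕ.* suc n) · 1#  ≡⟨ ×1-homo-* (suc m) (suc n) ⟩
      x * y                   ≡⟨ sym (-‿involutive _) ⟩
      - - (x * y)             ≡⟨ cong -_ (-‿distribʳ-* x y) ⟩
      - (x * - y)             ≡⟨ -‿distribˡ-* x (- y) ⟩
      - x * - y               ∎
      where
      open ≡-Reasoning
      x = suc m · 1#
      y = suc n · 1#

    homomorphism : ℤ.+-*-rawRing -Raw-AlmostCommutative⟶ fromCommutativeRing commutativeRing
    homomorphism = record
      { ⟦_⟧    = ⟦_⟧
      ; +-homo = +-homo
      ; *-homo = *-homo
      ; -‿homo = -‿homo
      ; 0-homo = refl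
      ; 1-homo = R.+-identityʳ 1#
      }

  open RingSolver ℤ.+-*-rawRing (fromCommutativeRing commutativeRing)
    IntegerCoefficients.homomorphism
    (λ i j → Maybe.map (cong IntegerCoefficients.⟦_⟧) (dec⇒maybe (i ℤ.≟ j)))
    public using (solve; _:=_; con; _:+_; _:-_; _:*_; :-_)

  -- a ≤ b follows from c ≤ d when the gaps agree; sums of hypotheses are fed in as c ≤ d.
  ≤-from : ∀ {a b c d} → c ≤ d → b - a ≡ d - c → a ≤ b
  ≤-from {a} {b} {c} {d} c≤d gap = subst₂ _≤_
    (solve 2 (λ a c → c :+ (a :- c) := a) refl a c)
    (trans (solve 3 (λ a c d → d :+ (a :- c) := a :+ (d :- c)) refl a c d)
      (trans (cong (a +_) (sym gap)) (solve 2 (λ a b → a :+ (b :- a) := b) refl a b)))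
    (+-monoˡ-≤ (a - c) c≤d)

  +-mono-≤ : ∀ {a b c d} → a ≤ b → c ≤ d → a + c ≤ b + d
  +-mono-≤ {a} {b} {c} {d} a≤b c≤d = ≤.trans (+-monoˡ-≤ c a≤b)
    (subst₂ _≤_ (R.+-comm c b) (R.+-comm d b) (+-monoˡ-≤ b c≤d))

  ≰⇒≥ : ∀ {x y} → ¬ x ≤ y → y ≤ x
  ≰⇒≥ {x} {y} x≰y with ≤.total x y
  ... | inj₁ x≤y = contradiction x≤y x≰y
  ... | inj₂ y≤x = y≤x

  ≰⇒< : ∀ {x y} → ¬ x ≤ y → y < x
  ≰⇒< x≰y = ≰⇒≥ x≰y , λ y≡x → x≰y (≤.reflexive (sym y≡x))

  <⇒≱ : ∀ {x y} → x < y → ¬ y ≤ x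
  <⇒≱ (x≤y , x≢y) y≤x = x≢y (≤.antisym x≤y y≤x)

  ≤∣x-y∣ : ∀ x y → x - y ≤ ∣ x - y ∣
  ≤∣x-y∣ x y = x≤x⊔y _ _

  ∣x-y∣≥ : ∀ x y → y - x ≤ ∣ x - y ∣
  ∣x-y∣≥ x y = ≤.trans (≤.reflexive (solve 2 (λ x y → y :- x := :- (x :- y)) refl x y)) (x≤y⊔x _ _)

  ∣x-y∣-lub : ∀ {x y z} → x - y ≤ z → y - x ≤ z → ∣ x - y ∣ ≤ z
  ∣x-y∣-lub {x} {y} p q = ⊔-lub p
    (≤.trans (≤.reflexive (solve 2 (λ x y → :- (x :- y) := y :- x) refl x y)) q)

  +≤⇒≤- : ∀ {x y z} → x + y ≤ z → y ≤ z - x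
  +≤⇒≤- {x} {y} {z} x+y≤z =
    ≤-from x+y≤z (solve 3 (λ x y z → (z :- x) :- y := z :- (x :+ y)) refl x y z)

  ≤-⇒+≤ : ∀ {x y z} → y ≤ z - x → x + y ≤ z
  ≤-⇒+≤ {x} {y} {z} y≤z-x =
    ≤-from y≤z-x (solve 3 (λ x y z → z :- (x :+ y) := (z :- x) :- y) refl x y z)

  x≤y⇒0≤y-x : ∀ {x y} → x ≤ y → 0# ≤ y - x
  x≤y⇒0≤y-x {x} {y} x≤y = ≤-from x≤y (solve 2 (λ x y → (y :- x) :- con 0ℤ := y :- x) refl x y)

  x≤x+y : ∀ {x y} → 0# ≤ y → x ≤ x + y
  x≤x+y {x} {y} 0≤y = ≤-from 0≤y (solve 2 (λ x y → (x :+ y) :- x := y :- con 0ℤ) refl x y)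

  y≤x+y : ∀ {x y} → 0# ≤ x → y ≤ x + y
  y≤x+y {x} {y} 0≤x = ≤-from 0≤x (solve 2 (λ x y → (x :+ y) :- y := x :- con 0ℤ) refl x y)

  x-y≤x : ∀ {x y} → 0# ≤ y → x - y ≤ x
  x-y≤x {x} {y} 0≤y = ≤-from 0≤y (solve 2 (λ x y → x :- (x :- y) := y :- con 0ℤ) refl x y)

  -‿anti-monoʳ-≤ : ∀ {x y z} → x ≤ y → z - y ≤ z - x
  -‿anti-monoʳ-≤ {x} {y} {z} x≤y =
    ≤-from x≤y (solve 3 (λ x y z → (z :- x) :- (z :- y) := y :- x) refl x y z)

  0≤∣x-y∣ : ∀ x y → 0# ≤ ∣ x - y ∣
  0≤∣x-y∣ x y with ≤.total x y
  ... | inj₁ x≤y = ≤.trans (x≤y⇒0≤y-x x≤y) (∣x-y∣≥ x y)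
  ... | inj₂ y≤x = ≤.trans (x≤y⇒0≤y-x y≤x) (≤∣x-y∣ x y)

  0≤1 : 0# ≤ 1#
  0≤1 with ≤.total 0# 1#
  ... | inj₁ 0≤1 = 0≤1
  ... | inj₂ 1≤0 = subst (0# ≤_) (trans (solve 1 (λ u → :- u :* :- u := u :* u) refl 1#) (R.*-identityˡ 1#))
                    (*-nonNeg 0≤-1 0≤-1)
    where
    0≤-1 : 0# ≤ - 1#
    0≤-1 = ≤-from 1≤0 (solve 1 (λ u → (:- u :- con 0ℤ) := con 0ℤ :- u) refl 1#)

  ≤-<-trans : ∀ {x y z} → x ≤ y → y < z → x < z
  ≤-<-trans x≤y y<z = ≤.trans x≤y (proj₁ y<z) , λ { refl → <⇒≱ y<z x≤y }

  <-≤-trans : ∀ {x y z} → x < y → y ≤ z → x < z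
  <-≤-trans x<y y≤z = ≤.trans (proj₁ x<y) y≤z , λ { refl → <⇒≱ x<y y≤z }

  -1<0 : - 1# < 0#
  -1<0 = ≤-from 0≤1 (solve 1 (λ u → con 0ℤ :- (:- u) := u :- con 0ℤ) refl 1#)
       , λ -1≡0 → 0≢1 (trans (sym -0#≈0#) (trans (cong -_ (sym -1≡0)) (-‿involutive 1#)))

  0≤n·1 : ∀ n → 0# ≤ n · 1#
  0≤n·1 zero    = ≤.refl
  0≤n·1 (suc n) = ≤.trans (0≤n·1 n) (y≤x+y 0≤1)

  n·-* : ∀ n x → n · x ≡ x * (n · 1#)
  n·-* n x = sym (trans (×-comm-* n x 1#) (cong (n ·_) (R.*-identityʳ x)))

  -- Dividing `c` by `suc n` gives a lower bound of `P`, which the greatest lower bound dominates.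
  -- This carries an estimate against each schedule over to the optimum, which is only given as an
  -- infimum.
  infimum-scale : ∀ n {P i c} → IsInfimum _≤_ P i → (∀ x → P x → c ≤ suc n · x) → c ≤ suc n · i
  infimum-scale n {P} {i} {c} inf c≤ = ≤-from (*-nonNeg (x≤y⇒0≤y-x cy≤i) (0≤n·1 (suc n)))
    (trans (cong (_- c) (n·-* (suc n) i)) (trans
      (cong (λ z → i * m - z) (sym (trans (cong (c *_) m*y≡1) (R.*-identityʳ c))))
      (solve 4 (λ i c m y → i :* m :- c :* (m :* y) := (i :- c :* y) :* m :- con 0ℤ) refl i c m y)))
    where
    open IsInfimum inf
    m = suc n · 1#

    m≢0 : m ≢ 0#
    m≢0 m≡0 = 0≢1 (≤.antisym 0≤1 (subst (1# ≤_) m≡0 (x≤x+y (0≤n·1 n))))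

    y = proj₁ (inverse m m≢0)
    m*y≡1 = proj₂ (inverse m m≢0)

    0≤y : 0# ≤ y
    0≤y = decidable-stable (0# ≤? y) λ 0≰y → <⇒≱ -1<0
      (subst (0# ≤_) (trans (solve 2 (λ m y → m :* (con 0ℤ :- y) := :- (m :* y)) refl m y) (cong -_ m*y≡1))
        (*-nonNeg (0≤n·1 (suc n)) (x≤y⇒0≤y-x (≰⇒≥ 0≰y))))

    cy≤i : c * y ≤ i
    cy≤i = greatest (c * y) λ x x∈ → ≤-from (*-nonNeg (x≤y⇒0≤y-x (c≤ x x∈)) 0≤y)
      (trans (cong (_- c * y) (sym (trans (cong (x *_) m*y≡1) (R.*-identityʳ x)))) (trans
        (solve 4 (λ x c m y → x :* (m :* y) :- c :* y := (x :* m :- c) :* y :- con 0ℤ) refl x c m y)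
        (cong (λ z → (z - c) * y - 0#) (sym (n·-* (suc n) x)))))

module Competitiveness (𝓡 : Reals) (X : FiniteSubset 𝓡) where

  open Service 𝓡 X
  open OrderedField 𝓡
  open DecMembership (Fin._≟_ {size}) using (_∈?_)

  -- Movement along the line

  coord-mono : ∀ {i j} → i Fin.≤ j → coord i ≤ coord j
  coord-mono {i} {j} i≤j with i Fin.≟ j
  ... | yes refl = ≤.refl
  ... | no  i≢j  = proj₁ (increasing (Fin.≤∧≢⇒< i≤j i≢j))

  d≥ : ∀ u v → coord u - coord v ≤ d u v
  d≥ u v = ≤∣x-y∣ _ _

  d≥′ : ∀ u v → coord v - coord u ≤ d u v
  d≥′ u v = ∣x-y∣≥ _ _

  0≤d : ∀ u v → 0# ≤ d u v
  0≤d u v = 0≤∣x-y∣ _ _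

  d-ascending : ∀ {u v} → u Fin.≤ v → d u v ≡ coord v - coord u
  d-ascending {u} {v} u≤v = ≤.antisym
    (∣x-y∣-lub (≤-from (+-mono-≤ (coord-mono u≤v) (coord-mono u≤v))
                 (solve 2 (λ u v → (v :- u) :- (u :- v) := (v :+ v) :- (u :+ u)) refl (coord u) (coord v)))
               ≤.refl)
    (d≥′ u v)

  d-descending : ∀ {u v} → v Fin.≤ u → d u v ≡ coord u - coord v
  d-descending {u} {v} v≤u = ≤.antisym
    (∣x-y∣-lub ≤.refl
      (≤-from (+-mono-≤ (coord-mono v≤u) (coord-mono v≤u))
        (solve 2 (λ u v → (v :- u) :- (u :- v) := (v :+ v) :- (u :+ u)) refl (coord v) (coord u))))
    (d≥ u v)

  0≤lenFrom : ∀ v vs → 0# ≤ lenFrom v vs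
  0≤lenFrom v []       = ≤.refl
  0≤lenFrom v (w ∷ vs) = ≤-from (+-mono-≤ (0≤d v w) (0≤lenFrom w vs))
    (solve 2 (λ a b → (a :+ b) :- con 0ℤ := (a :+ b) :- (con 0ℤ :+ con 0ℤ)) refl (d v w) (lenFrom w vs))

  lenFrom-++ : ∀ v xs ys → lenFrom v (xs ++ ys) ≡ lenFrom v xs + lenFrom (endFrom v xs) ys
  lenFrom-++ v []       ys = solve 1 (λ y → y := con 0ℤ :+ y) refl (lenFrom v ys)
  lenFrom-++ v (x ∷ xs) ys = trans (cong (d v x +_) (lenFrom-++ x xs ys))
    (solve 3 (λ a b c → a :+ (b :+ c) := (a :+ b) :+ c) refl _ _ _)

  endFrom-++ : ∀ v xs ys → endFrom v (xs ++ ys) ≡ endFrom (endFrom v xs) ys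
  endFrom-++ v []       ys = refl
  endFrom-++ v (x ∷ xs) ys = endFrom-++ x xs ys

  endFrom-∈ : ∀ v vs → endFrom v vs ∈ v ∷ vs
  endFrom-∈ v []       = here refl
  endFrom-∈ v (w ∷ vs) = there (endFrom-∈ w vs)

  Linked-++ : ∀ {R : Rel Site 0ℓ} v xs {ys} →
              Linked R (v ∷ xs) → Linked R (endFrom v xs ∷ ys) → Linked R (v ∷ xs ++ ys)
  Linked-++ v []       _           Rys = Rys
  Linked-++ v (x ∷ xs) (Rvx ∷ Rxs) Rys = Rvx ∷ Linked-++ x xs Rxs Rys

  d≤lenFrom : ∀ {v vs x} → x ∈ v ∷ vs → d v x ≤ lenFrom v vs
  d≤lenFrom {v} {vs} (here refl) =
    ∣x-y∣-lub v-v≤ v-v≤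
    where
    v-v≤ : coord v - coord v ≤ lenFrom v vs
    v-v≤ = ≤-from (0≤lenFrom v vs)
      (solve 2 (λ v l → l :- (v :- v) := l :- con 0ℤ) refl (coord v) (lenFrom v vs))
  d≤lenFrom {v} {w ∷ vs} {x} (there x∈) = ∣x-y∣-lub
    (≤-from (+-mono-≤ (d≥ v w) (≤.trans (d≥ w x) (d≤lenFrom x∈)))
      (solve 5 (λ v w x a b → (a :+ b) :- (v :- x) := (a :+ b) :- ((v :- w) :+ (w :- x))) refl
        (coord v) (coord w) (coord x) (d v w) (lenFrom w vs)))
    (≤-from (+-mono-≤ (d≥′ v w) (≤.trans (d≥′ w x) (d≤lenFrom x∈)))
      (solve 5 (λ v w x a b → (a :+ b) :- (x :- v) := (a :+ b) :- ((w :- v) :+ (x :- w))) refl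
        (coord v) (coord w) (coord x) (d v w) (lenFrom w vs)))

  -- Leading steps are dropped until one of the two vertices is the start of the walk; from there
  -- `d≤lenFrom` applies.
  spread≤lenFrom : ∀ {v vs x y} → x ∈ v ∷ vs → y ∈ v ∷ vs → coord x - coord y ≤ lenFrom v vs
  spread≤lenFrom (here refl) y∈          = ≤.trans (d≥ _ _) (d≤lenFrom y∈)
  spread≤lenFrom x∈          (here refl) = ≤.trans (d≥′ _ _) (d≤lenFrom x∈)
  spread≤lenFrom {v} {w ∷ vs} {x} {y} (there x∈) (there y∈) =
    ≤-from (+-mono-≤ (0≤d v w) (spread≤lenFrom x∈ y∈))
      (solve 4 (λ x y a b → (a :+ b) :- (x :- y) := (a :+ b) :- (con 0ℤ :+ (x :- y))) refl
        (coord x) (coord y) (d v w) (lenFrom w vs))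

  record Moves (u v : Site) (xs : List Site) : Set where
    field
      contiguous : Linked Step (u ∷ xs)
      arrives    : endFrom u xs ≡ v
      length≡d   : lenFrom u xs ≡ d u v

  -- Order and height are abstract so that one argument serves both directions: moves to the right
  -- use `coord`, moves to the left the reversed order and the negated coordinate.
  module MonotonePath
    (_≺_ : Rel Site 0ℓ)
    (≺-irrefl : ∀ {x} → ¬ x ≺ x)
    (≺-trans : ∀ {x y z} → x ≺ y → y ≺ z → x ≺ z)
    (≺-step : ∀ {x y} → x ≺ y → (∀ z → x ≺ z → ¬ z ≺ y) → Step x y)
    (height : Site → ℝ)
    (≺-height : ∀ {x y} → x ≺ y → d x y ≡ height y - height x)
    where

    _≼_ : Rel Site 0ℓ
    x ≼ y = x ≺ y ⊎ x ≡ y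

    -- The sorted list of exactly the sites beyond `u` up to `v` begins with the immediate successor
    -- of `u`, so no step jumps over a site, and the height differences telescope.
    path : ∀ u v xs → AllPairs _≺_ xs →
           (∀ {z} → z ∈ xs → u ≺ z × z ≼ v) → (∀ {z} → u ≺ z → z ≼ v → z ∈ xs) → u ≼ v →
           Linked Step (u ∷ xs) × endFrom u xs ≡ v × lenFrom u xs ≡ height v - height u
    path u v [] _ _ complete (inj₁ u≺v) with complete u≺v (inj₂ refl)
    ... | ()
    path u v [] _ _ _ (inj₂ refl) =
      [-] , refl , solve 1 (λ h → con 0ℤ := h :- h) refl (height u)
    path u v (x ∷ xs) (x≺xs ∷ ≺xs) sound complete _ =
      let u≺x , x≼v = sound (here refl)
          linked , arrives , len≡ = path x v xs ≺xs
            (λ z∈ → All.lookup x≺xs z∈ , proj₂ (sound (there z∈)))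
            (λ x≺z z≼v → drop-head x≺z (complete (≺-trans u≺x x≺z) z≼v))
            x≼v
      in ≺-step u≺x (λ z u≺z z≺x → not-before z≺x (complete u≺z (before z≺x x≼v))) ∷ linked
       , arrives
       , trans (cong₂ _+_ (≺-height u≺x) len≡)
           (solve 3 (λ u x v → (x :- u) :+ (v :- x) := v :- u) refl (height u) (height x) (height v))
      where
      drop-head : ∀ {z} → x ≺ z → z ∈ x ∷ xs → z ∈ xs
      drop-head x≺x (here refl) = contradiction x≺x ≺-irrefl
      drop-head _   (there z∈)  = z∈

      before : ∀ {z} → z ≺ x → x ≼ v → z ≼ v
      before z≺x (inj₁ x≺v)  = inj₁ (≺-trans z≺x x≺v)
      before z≺x (inj₂ refl) = inj₁ z≺x

      not-before : ∀ {z} → z ≺ x → ¬ z ∈ x ∷ xs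
      not-before z≺x (here refl) = ≺-irrefl z≺x
      not-before z≺x (there z∈)  = ≺-irrefl (≺-trans z≺x (All.lookup x≺xs z∈))

  module Ascending = MonotonePath Fin._<_ (Fin.<-irrefl refl) Fin.<-trans
    (λ x<y gap z → (λ (x<z , z<y) → gap z x<z z<y)
                 , (λ (y<z , z<x) → Fin.<-asym x<y (Fin.<-trans y<z z<x)))
    coord (d-ascending ∘ ℕ.<⇒≤)

  module Descending = MonotonePath (flip Fin._<_) (Fin.<-irrefl refl) (flip Fin.<-trans)
    (λ y<x gap z → (λ (x<z , z<y) → Fin.<-asym y<x (Fin.<-trans x<z z<y))
                 , (λ (y<z , z<x) → gap z z<x y<z))
    (-_ ∘ coord)
    (λ y<x → trans (d-descending (ℕ.<⇒≤ y<x))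
               (solve 2 (λ x y → x :- y := :- y :- :- x) refl _ _))

  private
    up? : (u v z : Site) → Dec (u Fin.< z × z Fin.≤ v)
    up? u v z = (u Fin.<? z) ×-dec (z Fin.≤? v)

    down? : (u v z : Site) → Dec (v Fin.≤ z × z Fin.< u)
    down? u v z = (v Fin.≤? z) ×-dec (z Fin.<? u)

    ≤⇒<⊎≡ : ∀ {x y : Site} → x Fin.≤ y → x Fin.< y ⊎ x ≡ y
    ≤⇒<⊎≡ {x} {y} x≤y with x Fin.≟ y
    ... | yes x≡y = inj₂ x≡y
    ... | no  x≢y = inj₁ (Fin.≤∧≢⇒< x≤y x≢y)

    <⊎≡⇒≤ : ∀ {x y : Site} → x Fin.< y ⊎ x ≡ y → x Fin.≤ y
    <⊎≡⇒≤ (inj₁ x<y)  = ℕ.<⇒≤ x<y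
    <⊎≡⇒≤ (inj₂ refl) = ℕ.≤-refl

  allFin-sorted : AllPairs Fin._<_ (allFin size)
  allFin-sorted = AllPairs.tabulate⁺-< (λ i<j → i<j)

  moves-ascending : ∀ {u v} → u Fin.≤ v → moves u v ≡ filter (up? u v) (allFin size)
  moves-ascending {u} {v} u≤v = trans
    (cong (λ ys → filter (up? u v) (allFin size) ++ reverse ys)
      (filter-none (down? u v) {xs = allFin size} (All.universal (λ z (v≤z , z<u) → ℕ.<⇒≱ z<u (ℕ.≤-trans u≤v v≤z)) _)))
    (++-identityʳ _)

  moves-descending : ∀ {u v} → v Fin.≤ u → moves u v ≡ reverse (filter (down? u v) (allFin size))
  moves-descending {u} {v} v≤u = cong (_++ reverse (filter (down? u v) (allFin size)))
    (filter-none (up? u v) {xs = allFin size} (All.universal (λ z (u<z , z≤v) → ℕ.<⇒≱ u<z (ℕ.≤-trans z≤v v≤u)) _))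

  moves-Moves : ∀ u v → Moves u v (moves u v)
  moves-Moves u v with Fin.≤-total u v
  ... | inj₁ u≤v rewrite moves-ascending u≤v =
    let linked , arrives , len≡ = Ascending.path u v _
          (AllPairs.filter⁺ (up? u v) allFin-sorted)
          (λ z∈ → let u<z , z≤v = proj₂ (∈-filter⁻ (up? u v) {xs = allFin size} z∈) in u<z , ≤⇒<⊎≡ z≤v)
          (λ u<z z≼v → ∈-filter⁺ (up? u v) (∈-allFin _) (u<z , <⊎≡⇒≤ z≼v))
          (≤⇒<⊎≡ u≤v)
    in record { contiguous = linked ; arrives = arrives
              ; length≡d = trans len≡ (sym (d-ascending u≤v)) }
  ... | inj₂ v≤u rewrite moves-descending v≤u =
    let linked , arrives , len≡ = Descending.path u v _
          (AllPairs-reverse (AllPairs.filter⁺ (down? u v) allFin-sorted))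
          (λ z∈ → let v≤z , z<u = proj₂ (∈-filter⁻ (down? u v) {xs = allFin size} (Any.reverse⁻ z∈))
                  in z<u , flip-≼ (≤⇒<⊎≡ v≤z))
          (λ z<u z≼v → Any.reverse⁺ (∈-filter⁺ (down? u v) (∈-allFin _) (<⊎≡⇒≤ (unflip-≼ z≼v) , z<u)))
          (flip-≼ (≤⇒<⊎≡ v≤u))
    in record { contiguous = linked ; arrives = arrives
              ; length≡d = trans len≡ (trans (solve 2 (λ u v → :- v :- :- u := u :- v) refl (coord u) (coord v))
                                             (sym (d-descending v≤u))) }
    where
    flip-≼ : ∀ {x y} → x Fin.< y ⊎ x ≡ y → y Descending.≼ x
    flip-≼ (inj₁ x<y) = inj₁ x<y
    flip-≼ (inj₂ x≡y) = inj₂ (sym x≡y)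

    unflip-≼ : ∀ {x y} → y Descending.≼ x → x Fin.< y ⊎ x ≡ y
    unflip-≼ (inj₁ x<y) = inj₁ x<y
    unflip-≼ (inj₂ y≡x) = inj₂ (sym y≡x)

  moves-∈-ascending : ∀ {u v z} → u Fin.< z → z Fin.≤ v → z ∈ moves u v
  moves-∈-ascending {u} {v} u<z z≤v = ∈-++⁺ˡ (∈-filter⁺ (up? u v) (∈-allFin _) (u<z , z≤v))

  moves-∈-descending : ∀ {u v z} → v Fin.≤ z → z Fin.< u → z ∈ moves u v
  moves-∈-descending {u} {v} v≤z z<u =
    ∈-++⁺ʳ _ (Any.reverse⁺ (∈-filter⁺ (down? u v) (∈-allFin _) (v≤z , z<u)))

  near-far : ∀ e H → (near e H ≡ left H × far e H ≡ right H)
                   ⊎ (near e H ≡ right H × far e H ≡ left H)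
  near-far e [ l , r ]ᴵ with d e l ≤? d e r
  ... | yes _ = inj₁ (refl , refl)
  ... | no  _ = inj₂ (refl , refl)

  module _ (e : Site) (H : Interval) where
    private
      n = near e H
      f = far e H
      module e⟶n = Moves (moves-Moves e n)
      module n⟶f = Moves (moves-Moves n f)

    end-sweep : end (sweep e H) ≡ f
    end-sweep = trans (endFrom-++ e (moves e n) (moves n f))
      (trans (cong (λ v → endFrom v (moves n f)) e⟶n.arrives) n⟶f.arrives)

    len-sweep : len (sweep e H) ≡ d e n + d n f
    len-sweep = trans (lenFrom-++ e (moves e n) (moves n f))
      (cong₂ _+_ e⟶n.length≡d
        (trans (cong (λ v → lenFrom v (moves n f)) e⟶n.arrives) n⟶f.length≡d))

    sweep-contiguous : Linked Step (toList (sweep e H))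
    sweep-contiguous = Linked-++ e (moves e n) e⟶n.contiguous
      (subst (λ v → Linked Step (v ∷ moves n f)) (sym e⟶n.arrives) n⟶f.contiguous)

    near-∈-sweep : n ∈ toList (sweep e H)
    near-∈-sweep = ∈-++⁺ˡ (subst (_∈ e ∷ moves e n) e⟶n.arrives (endFrom-∈ e (moves e n)))

    sweep-covers : ∀ {z} → left H Fin.≤ z → z Fin.≤ right H → z ∈ toList (sweep e H)
    sweep-covers {z} l≤z z≤r with z Fin.≟ n
    ... | yes refl = near-∈-sweep
    ... | no  z≢n with near-far e H
    ...   | inj₁ (n≡l , f≡r) = there (∈-++⁺ʳ (moves e n) (moves-∈-ascending
              (Fin.≤∧≢⇒< (subst (Fin._≤ z) (sym n≡l) l≤z) (z≢n ∘ sym)) (subst (z Fin.≤_) (sym f≡r) z≤r)))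
    ...   | inj₂ (n≡r , f≡l) = there (∈-++⁺ʳ (moves e n) (moves-∈-descending
              (subst (Fin._≤ z) (sym f≡l) l≤z) (Fin.≤∧≢⇒< (subst (z Fin.≤_) (sym n≡r) z≤r) z≢n)))

  0≤dist : ∀ H H′ → 0# ≤ dist H H′
  0≤dist H H′ = ≤.trans (x≤x⊔y _ _) (x≤x⊔y _ _)

  dist-left : ∀ H H′ → coord (left H′) - coord (right H) ≤ dist H H′
  dist-left H H′ = ≤.trans (x≤y⊔x _ _) (x≤x⊔y _ _)

  dist-right : ∀ H H′ → coord (left H) - coord (right H′) ≤ dist H H′
  dist-right H H′ = x≤y⊔x _ _

  _∈ᴵ_ : Site → Interval → Set
  z ∈ᴵ H = left H Fin.≤ z × z Fin.≤ right H

  -- The signed differences are at most `r - l′` and `r′ - l`. Subtracting both diameters leaves the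
  -- signed gaps `l - r′` and `l′ - r`, and `dist` dominates each.
  d≤diam+dist+diam : ∀ {H H′ x y} → x ∈ᴵ H → y ∈ᴵ H′ → d x y ≤ diam H + dist H H′ + diam H′
  d≤diam+dist+diam {[ l , r ]ᴵ} {[ l′ , r′ ]ᴵ} {x} {y} (l≤x , x≤r) (l′≤y , y≤r′) = ∣x-y∣-lub
    (≤-from (+-mono-≤ (+-mono-≤ (coord-mono x≤r) (coord-mono l′≤y))
                      (dist-right [ l , r ]ᴵ [ l′ , r′ ]ᴵ))
      (solve 7 (λ l r l′ r′ x y δ → ((r :- l) :+ δ :+ (r′ :- l′)) :- (x :- y)
                                   := ((r :+ y) :+ δ) :- ((x :+ l′) :+ (l :- r′))) refl
        (coord l) (coord r) (coord l′) (coord r′) (coord x) (coord y) (dist [ l , r ]ᴵ [ l′ , r′ ]ᴵ)))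
    (≤-from (+-mono-≤ (+-mono-≤ (coord-mono l≤x) (coord-mono y≤r′))
                      (dist-left [ l , r ]ᴵ [ l′ , r′ ]ᴵ))
      (solve 7 (λ l r l′ r′ x y δ → ((r :- l) :+ δ :+ (r′ :- l′)) :- (y :- x)
                                   := ((x :+ r′) :+ δ) :- ((l :+ y) :+ (l′ :- r))) refl
        (coord l) (coord r) (coord l′) (coord r′) (coord x) (coord y) (dist [ l , r ]ᴵ [ l′ , r′ ]ᴵ)))

  module _ {e : Site} {H : Interval} (l≤r : left H Fin.≤ right H) where

    near∈H : near e H ∈ᴵ H
    near∈H with near-far e H
    ... | inj₁ (n≡l , _) rewrite n≡l = ℕ.≤-refl , l≤r
    ... | inj₂ (n≡r , _) rewrite n≡r = l≤r , ℕ.≤-refl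

    far∈H : far e H ∈ᴵ H
    far∈H with near-far e H
    ... | inj₁ (_ , f≡r) rewrite f≡r = l≤r , ℕ.≤-refl
    ... | inj₂ (_ , f≡l) rewrite f≡l = ℕ.≤-refl , l≤r

    d-near-far : d (near e H) (far e H) ≡ diam H
    d-near-far with near-far e H
    ... | inj₁ (n≡l , f≡r) rewrite n≡l | f≡r = d-ascending l≤r
    ... | inj₂ (n≡r , f≡l) rewrite n≡r | f≡l = d-descending l≤r

    len-sweep≤ : ∀ {H₀} → e ∈ᴵ H₀ → len (sweep e H) ≤ diam H₀ + dist H₀ H + diam H + diam H
    len-sweep≤ e∈H₀ = ≤.trans (≤.reflexive (trans (len-sweep e H) (cong (d e (near e H) +_) d-near-far)))
                         (+-monoˡ-≤ (diam H) (d≤diam+dist+diam e∈H₀ near∈H))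

  -- Phases of the algorithm

  delay≤maxDelay : ∀ {t q qs} → q ∈ qs → t - arrival q ≤ maxDelay t qs
  delay≤maxDelay (here refl) = x≤x⊔y _ _
  delay≤maxDelay (there q∈)  = ≤.trans (delay≤maxDelay q∈) (x≤y⊔x _ _)

  0≤maxDelay : ∀ t qs → 0# ≤ maxDelay t qs
  0≤maxDelay t []       = ≤.refl
  0≤maxDelay t (q ∷ qs) = ≤.trans (0≤maxDelay t qs) (x≤y⊔x _ _)

  maxDelay-lub : ∀ {t m} qs → 0# ≤ m → (∀ {q} → q ∈ qs → t - arrival q ≤ m) → maxDelay t qs ≤ m
  maxDelay-lub []       0≤m _    = 0≤m
  maxDelay-lub (q ∷ qs) 0≤m each = ⊔-lub (each (here refl)) (maxDelay-lub qs 0≤m (each ∘ there))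

  module _ {t : ℝ} {q : Request} where

    ∈-after⁺ : ∀ {R} → q ∈ R → ¬ arrival q ≤ t → q ∈ after t R
    ∈-after⁺ = ∈-filter⁺ (λ q → ¬? (arrival q ≤? t))

    ∈-after⁻ : ∀ {R} → q ∈ after t R → q ∈ R × ¬ arrival q ≤ t
    ∈-after⁻ = ∈-filter⁻ (λ q → ¬? (arrival q ≤? t))

    arrive-pending⁺ : ∀ {σ} → q ∈ pending σ → q ∈ pending (arrive t σ)
    arrive-pending⁺ = ∈-++⁺ˡ

    arrive-upcoming⁺ : ∀ {σ} → q ∈ upcoming σ → arrival q ≤ t → location q ≢ position σ →
                       q ∈ pending (arrive t σ)
    arrive-upcoming⁺ {σ} q∈ a≤t ≢pos = ∈-++⁺ʳ (pending σ)
      (∈-filter⁺ (λ q → ¬? (location q Fin.≟ position σ)) (∈-filter⁺ (λ q → arrival q ≤? t) q∈ a≤t) ≢pos)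

    arrive⁻ : ∀ {σ} → q ∈ pending (arrive t σ) →
              q ∈ pending σ ⊎ (q ∈ upcoming σ × arrival q ≤ t × location q ≢ position σ)
    arrive⁻ {σ} q∈ with ∈-++⁻ (pending σ) q∈
    ... | inj₁ q∈pending = inj₁ q∈pending
    ... | inj₂ q∈new =
      let q∈arrived , ≢pos = ∈-filter⁻ (λ q → ¬? (location q Fin.≟ position σ))
                               {xs = filter (λ q → arrival q ≤? t) (upcoming σ)} q∈new
          q∈upcoming , a≤t = ∈-filter⁻ (λ q → arrival q ≤? t) {xs = upcoming σ} q∈arrived
      in inj₂ (q∈upcoming , a≤t , ≢pos)

    module _ {P : Walk} where

      served⁺ : ∀ {qs} → q ∈ qs → location q ∈ toList P → q ∈ served P qs
      served⁺ = ∈-filter⁺ (λ q → location q ∈? toList P)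

      served⁻ : ∀ {qs} → q ∈ served P qs → q ∈ qs
      served⁻ {qs} q∈ = proj₁ (∈-filter⁻ (λ q → location q ∈? toList P) {xs = qs} q∈)

      afterWalk⁺ : ∀ {σ} → q ∈ pending σ → ¬ location q ∈ toList P → q ∈ pending (afterWalk P σ)
      afterWalk⁺ = ∈-filter⁺ (λ q → ¬? (location q ∈? toList P))

      afterWalk⁻ : ∀ {σ} → q ∈ pending (afterWalk P σ) → q ∈ pending σ
      afterWalk⁻ {σ} q∈ = proj₁ (∈-filter⁻ (λ q → ¬? (location q ∈? toList P)) {xs = pending σ} q∈)

  latest : ∀ m (qs : List Request) → ∃ λ M → m ≤ M × All (λ q → arrival q ≤ M) qs
  latest m []       = m , ≤.refl , []
  latest m (q ∷ qs) =
    let M , m≤M , qs≤M = latest m qs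
    in arrival q ⊔ M , ≤.trans m≤M (x≤y⊔x _ _)
     , x≤x⊔y _ _ ∷ All.map (λ ≤M → ≤.trans ≤M (x≤y⊔x _ _)) qs≤M

  -- `s` is the first arrival after `t`, capped at `g`. It delimits a stretch of time after `t` on
  -- which the hull does not change.
  next : ∀ t g (qs : List Request) → t < g →
         ∃ λ s → t < s × s ≤ g × All (λ q → arrival q < s → arrival q ≤ t) qs
  next t g []       t<g = g , t<g , ≤.refl , []
  next t g (q ∷ qs) t<g with next t g qs t<g | arrival q ≤? t
  ... | s , t<s , s≤g , gap | yes a≤t = s , t<s , s≤g , (λ _ → a≤t) ∷ gap
  ... | s , t<s , s≤g , gap | no  a≰t with s ≤? arrival q
  ...   | yes s≤a = s , t<s , s≤g , (λ a<s → contradiction s≤a (<⇒≱ a<s)) ∷ gap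
  ...   | no  s≰a = arrival q , ≰⇒< a≰t , ≤.trans (≰⇒≥ s≰a) s≤g
                  , (λ a<a → contradiction refl (proj₂ a<a))
                  ∷ All.map (λ f a<a′ → f (<-≤-trans a<a′ (≰⇒≥ s≰a))) gap

  module _ (α : ℝ) (b : ℝ → ℝ) (R : List Request)
    (b-cong : ∀ {r t} → t ≤ r → (∀ {q} → q ∈ R → arrival q ≤ r → arrival q ≤ t) → b r ≡ b t)
    where

    private
      Triggers : ℝ → Set
      Triggers t = α ≤ t × b t ≤ t - α

    -- After the last arrival `M` the bound stays at `b M` while the elapsed time grows without
    -- limit.
    eventually : ∃ Triggers
    eventually with latest α R
    ... | M , α≤M , R≤M = _ , settled (x≤x⊔y M (α + b M)) (x≤y⊔x M (α + b M))
      where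
      settled : ∀ {t} → M ≤ t → α + b M ≤ t → Triggers t
      settled {t} M≤t α+b≤t = ≤.trans α≤M M≤t
        , subst (_≤ t - α) (sym (b-cong M≤t (λ q∈ _ → All.lookup R≤M q∈))) (+≤⇒≤- α+b≤t)

    -- The infimum of the trigger times is attained: b is constant until the next arrival.
    least : ∃ (IsLeast _≤_ Triggers)
    least = t , record { holds = α≤t , decidable-stable (b t ≤? t - α) attained ; lowerBound = t≤ }
      where
      infimum = complete Triggers eventually (α , λ _ → proj₁)
      t = proj₁ infimum
      open IsInfimum (proj₂ infimum) renaming (lowerBound to t≤)

      α≤t : α ≤ t
      α≤t = greatest α (λ _ → proj₁)

      attained : ¬ ¬ b t ≤ t - α
      attained b≰ =
        -- If `b t` exceeded `t - α`, then up to the next arrival the bound would still be `b t`, so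
        -- nothing could trigger before `α + b t`. The earlier of these two times would be a lower
        -- bound of the trigger times lying above their infimum.
        let s , t<s , s≤g , gap = next t (α + b t) R (≰⇒< (λ g≤t → b≰ (+≤⇒≤- g≤t)))
        in <⇒≱ t<s (greatest s (λ r triggers → later s s≤g gap r triggers (s ≤? r)))
        where
        later : ∀ s → s ≤ α + b t → All (λ q → arrival q < s → arrival q ≤ t) R →
                ∀ r → Triggers r → Dec (s ≤ r) → s ≤ r
        later s s≤g gap r _ (yes s≤r) = s≤r
        later s s≤g gap r (α≤r , b≤) (no s≰r) = ≤.trans s≤g (≤-⇒+≤
          (subst (_≤ r - α) (b-cong (t≤ r (α≤r , b≤)) λ q∈ a≤r → All.lookup gap q∈ (a<s a≤r)) b≤))
          where
          a<s : ∀ {x} → x ≤ r → x < s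
          a<s x≤r = ≤.trans x≤r (≰⇒≥ s≰r) , λ { refl → s≰r x≤r }

  private
    module SiteExtrema = Extrema (Fin.≤-totalOrder size)

  Requested : List Request → ℝ → Site → Set
  Requested R t z = ∃ λ q → q ∈ R × arrival q ≤ t × location q ≡ z

  module _ (H₀ : Interval) (R : List Request) (q₀ : Request) where

    open Phase H₀ R q₀

    H-ordered : ∀ t → left (H t) Fin.≤ right (H t)
    H-ordered t = ℕ.≤-trans (SiteExtrema.min≤⊤ (location q₀) (map location (V t)))
                             (SiteExtrema.⊥≤max (location q₀) (map location (V t)))

    V⁺ : ∀ {q t} → q ∈ R → α ≤ arrival q → arrival q ≤ t → q ∈ V t
    V⁺ {t = t} q∈ α≤ ≤t = ∈-filter⁺ (λ q → (α ≤? arrival q) ×-dec (arrival q ≤? t)) q∈ (α≤ , ≤t)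

    V⁻ : ∀ {q t} → q ∈ V t → q ∈ R × α ≤ arrival q × arrival q ≤ t
    V⁻ {t = t} = ∈-filter⁻ (λ q → (α ≤? arrival q) ×-dec (arrival q ≤? t))

    location∈H : ∀ {q t} → q ∈ R → α ≤ arrival q → arrival q ≤ t → location q ∈ᴵ H t
    location∈H {t = t} q∈ α≤ ≤t =
      let loc∈ = ∈-map⁺ location (V⁺ q∈ α≤ ≤t)
      in All.lookup (SiteExtrema.min≤xs (location q₀) (map location (V t))) loc∈
       , All.lookup (SiteExtrema.xs≤max (location q₀) (map location (V t))) loc∈

    module _ (q₀∈R : q₀ ∈ R) {t : ℝ} (α≤t : α ≤ t) where

      private
        requested : ∀ {z} → z ≡ location q₀ ⊎ z ∈ map location (V t) → Requested R t z
        requested (inj₁ refl) = q₀ , q₀∈R , α≤t , refl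
        requested (inj₂ z∈) =
          let q , q∈V , z≡ = ∈-map⁻ location z∈
              q∈R , _ , a≤t = V⁻ q∈V
          in q , q∈R , a≤t , sym z≡

      left-requested : Requested R t (left (H t))
      left-requested = requested (SiteExtrema.argmin-sel id (location q₀) (map location (V t)))

      right-requested : Requested R t (right (H t))
      right-requested = requested (SiteExtrema.argmax-sel id (location q₀) (map location (V t)))

    b-cong : ∀ {r t} → t ≤ r → (∀ {q} → q ∈ R → arrival q ≤ r → arrival q ≤ t) → b r ≡ b t
    b-cong {r} {t} t≤r settled = cong bound (filter-cong _ _ R
      (λ q∈ (α≤ , ≤r) → α≤ , settled q∈ ≤r) (λ q∈ (α≤ , ≤t) → α≤ , ≤.trans ≤t t≤r))
      where
      bound : List Request → ℝ
      bound qs = diam I + dist H₀ I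
        where I = [ SiteExtrema.min (location q₀) (map location qs) , SiteExtrema.max (location q₀) (map location qs) ]ᴵ

    leastTrigger : ∃ (IsLeast _≤_ Triggers)
    leastTrigger = least α b R b-cong

  -- `earliest` is the minimality of the trigger time. Of the hull at time `r` it keeps only that
  -- its endpoints were requested by then, which is all that the offline argument uses.
  record IsPhase (e : Site) (H₀ : Interval) (R : List Request) (q₀ : Request) (t : ℝ) (h : Interval) : Set where
    α = arrival q₀
    field
      started    : q₀ ∈ R
      first      : ∀ {q} → q ∈ R → location q ≢ e → α ≤ arrival q
      α≤t        : α ≤ t
      triggered  : diam h + dist H₀ h ≤ t - α
      left≤right : left h Fin.≤ right h
      covers     : ∀ {q} → q ∈ R → α ≤ arrival q → arrival q ≤ t → location q ∈ᴵ h
      endpoints  : Requested R t (left h) × Requested R t (right h)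
      earliest   : ∀ {r} → α ≤ r → ∃ λ h′ → left h′ Fin.≤ right h′
                   × Requested R r (left h′) × Requested R r (right h′)
                   × (diam h′ + dist H₀ h′ ≤ r - α → t ≤ r)

  -- Run with the hull of each phase as an argument, known only through IsPhase: computing with
  -- the hulls of Run would unfold them.
  data Phases (e : Site) (H₀ : Interval) (R : List Request) : Schedule → Set where
    idle  : All (λ q → location q ≡ e) R → Phases e H₀ R []
    phase : ∀ {q₀ t S h} → Phases (far e h) h (after t R) S → IsPhase e H₀ R q₀ t h →
            Phases e H₀ R (([ sweep e h ] at t) ∷ S)

  isPhase : ∀ {e H₀ R q₀ t h} → h ≡ Phase.H H₀ R q₀ t → q₀ ∈ R →
            (∀ q → q ∈ R → location q ≢ e → arrival q₀ ≤ arrival q) →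
            IsLeast _≤_ (Phase.Triggers H₀ R q₀) t → IsPhase e H₀ R q₀ t h
  isPhase {e} {H₀} {R} {q₀} {t} refl q₀∈R first least = record
    { started    = q₀∈R
    ; first      = λ {q} → first q
    ; α≤t        = proj₁ holds
    ; triggered  = proj₂ holds
    ; left≤right = H-ordered H₀ R q₀ t
    ; covers     = location∈H H₀ R q₀
    ; endpoints  = left-requested H₀ R q₀ q₀∈R (proj₁ holds) , right-requested H₀ R q₀ q₀∈R (proj₁ holds)
    ; earliest   = λ {r} α≤r → Phase.H H₀ R q₀ r , H-ordered H₀ R q₀ r
                 , left-requested H₀ R q₀ q₀∈R α≤r , right-requested H₀ R q₀ q₀∈R α≤r
                 , λ b≤ → lowerBound r (α≤r , b≤)
    }
    where open IsLeast least

  phases : ∀ {e H₀ R S} → Run e H₀ R S → Phases e H₀ R S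
  phases (idle all≡e)                   = idle all≡e
  phases (phase q₀∈R _ first least run) = phase (phases run) (isPhase refl q₀∈R first least)

  -- Cost and feasibility of the algorithm

  private
    module TimeExtrema = Extrema ≤.totalOrder

  -- The request that starts a phase has arrived when the phase ends, so each phase shortens the
  -- list of requests to come; `n` bounds its length.
  run-exists : ∀ n e H₀ R → length R ℕ.≤ n → ∃ (Run e H₀ R)
  run-exists n e H₀ R |R|≤n with All.all? (λ q → location q Fin.≟ e) R
  ... | yes all≡e = [] , idle all≡e
  ... | no ¬all≡e with find (All.¬All⇒Any¬ (λ q → location q Fin.≟ e) R ¬all≡e)
  ...   | q , q∈R , q≢e = continue n |R|≤n
    where
    ≢e? = λ q → ¬? (location q Fin.≟ e)

    q₀ : Request
    -- The default `q` is itself a request away from `e`, so it cannot spoil the choice.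
    q₀ = TimeExtrema.argmin arrival q (elsewhere e R)

    q₀-props : q₀ ∈ R × location q₀ ≢ e
    q₀-props = TimeExtrema.argmin-all arrival (q∈R , q≢e) (All.tabulate (∈-filter⁻ ≢e?))

    first : ∀ q′ → q′ ∈ R → location q′ ≢ e → arrival q₀ ≤ arrival q′
    first q′ q′∈R q′≢e = All.lookup (TimeExtrema.f[argmin]≤f[xs] q (elsewhere e R)) (∈-filter⁺ ≢e? q′∈R q′≢e)

    trigger : ∃ (IsLeast _≤_ (Phase.Triggers H₀ R q₀))
    trigger = leastTrigger H₀ R q₀

    t : ℝ
    t = proj₁ trigger

    shorter : length (after t R) ℕ.< length R
    shorter = filter-notAll (λ q → ¬? (arrival q ≤? t)) R
      (lose (proj₁ q₀-props) (λ a≰t → a≰t (proj₁ (IsLeast.holds (proj₂ trigger)))))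

    continue : ∀ n → length R ℕ.≤ n → ∃ (Run e H₀ R)
    continue zero    |R|≤0  = contradiction (ℕ.<-≤-trans shorter |R|≤0) ℕ.n≮0
    continue (suc n) |R|≤1+n =
      let open Phase H₀ R q₀
          S , run = run-exists n (far e (H t)) (H t) (after t R) (ℕ.s≤s⁻¹ (ℕ.<-≤-trans shorter |R|≤1+n))
      in _ , phase (proj₁ q₀-props) (proj₂ q₀-props) first (proj₂ trigger) run

  -- This is the `∑ Tᵢ` of the overview.
  waiting : ∀ {e H₀ R S} → Phases e H₀ R S → ℝ
  waiting (idle _)                     = 0#
  waiting (phase {q₀} {t} run _) = (t - arrival q₀) + waiting run

  module _ {e H₀ R q₀ t h} (isPhase : IsPhase e H₀ R q₀ t h) where

    open IsPhase isPhase

    private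
      σ : State
      σ = arrive t ⟨ e , [] , R ⟩

      pending-in-phase : ∀ {q} → q ∈ pending σ → q ∈ R × α ≤ arrival q × arrival q ≤ t
      pending-in-phase q∈ with arrive⁻ {t} {_} {⟨ e , [] , R ⟩} q∈
      ... | inj₂ (q∈R , a≤t , ≢e) = q∈R , first q∈R ≢e , a≤t

    -- Requests arriving before `α` lie at `e` and are served on arrival. Whatever is pending at `t`
    -- therefore belongs to the virtual set and lies in the hull, all of which the sweep visits.
    sweep-serves : afterWalk (sweep e h) σ ≡ ⟨ far e h , [] , after t R ⟩
    sweep-serves = cong₂ (λ v qs → ⟨ v , qs , after t R ⟩) (end-sweep e h)
      (filter-none _ (All.tabulate λ q∈ unserved →
        let q∈R , α≤a , a≤t = pending-in-phase q∈
            l≤ , ≤r = covers q∈R α≤a a≤t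
        in unserved (sweep-covers e h l≤ ≤r)))

    phase-delay : ∀ P → maxDelay t (served P (pending σ)) ≤ t - α
    phase-delay P = maxDelay-lub (served P (pending σ)) (x≤y⇒0≤y-x α≤t)
      λ q∈ → -‿anti-monoʳ-≤ (proj₁ (proj₂ (pending-in-phase (served⁻ {t} {_} {P} q∈))))

    phase-cost : ∀ S w → e ∈ᴵ H₀ → costFrom ⟨ far e h , [] , after t R ⟩ S ≤ diam h + 4 · w →
                 costFrom ⟨ e , [] , R ⟩ (([ sweep e h ] at t) ∷ S) ≤ diam H₀ + 4 · ((t - α) + w)
    phase-cost S w e∈H₀ rest = telescope
      (+-mono-≤ (len-sweep≤ {e} {h} left≤right {H₀} e∈H₀) (phase-delay (sweep e h)))
      (subst (λ σ → costFrom σ S ≤ diam h + 4 · w) (sym sweep-serves) rest)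
      triggered (0≤dist H₀ h)
      where
      telescope : ∀ {D₀ δ D T w c c′} → c ≤ (D₀ + δ + D + D) + T → c′ ≤ D + 4 · w → D + δ ≤ T → 0# ≤ δ →
                  (c + 0#) + c′ ≤ D₀ + 4 · (T + w)
      telescope {D₀} {δ} {D} {T} {w} {c} {c′} c≤ c′≤ b≤T 0≤δ = ≤-from
        -- The excess `3D + δ` equals `3(D + δ) - 2δ`, whence three uses of the trigger bound and
        -- two of `0≤δ`.
        (+-mono-≤ (+-mono-≤ c≤ c′≤) (+-mono-≤ (+-mono-≤ b≤T (+-mono-≤ b≤T b≤T)) (+-mono-≤ 0≤δ 0≤δ)))
        (solve 7 (λ D₀ δ D T w c c′ →
            (D₀ :+ ((T :+ w) :+ ((T :+ w) :+ ((T :+ w) :+ ((T :+ w) :+ con 0ℤ))))) :- ((c :+ con 0ℤ) :+ c′)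
          := (((((D₀ :+ δ :+ D) :+ D) :+ T) :+ (D :+ (w :+ (w :+ (w :+ (w :+ con 0ℤ))))))
                :+ ((T :+ (T :+ T)) :+ (δ :+ δ)))
             :- ((c :+ c′) :+ (((D :+ δ) :+ ((D :+ δ) :+ (D :+ δ))) :+ (con 0ℤ :+ con 0ℤ)))) refl
          D₀ δ D T w c c′)

  -- A sweep starts somewhere in the previous hull and may have to cross all of it. The potential
  -- `diam H₀` prepays this crossing, and each phase leaves `diam h` to its successor.
  phases-cost : ∀ {e H₀ R S} (run : Phases e H₀ R S) → e ∈ᴵ H₀ →
                costFrom ⟨ e , [] , R ⟩ S ≤ diam H₀ + 4 · waiting run
  phases-cost {H₀ = [ l , r ]ᴵ} (idle _) (l≤e , e≤r) = ≤-from (coord-mono (ℕ.≤-trans l≤e e≤r))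
    (solve 2 (λ l r → ((r :- l) :+ (con 0ℤ :+ (con 0ℤ :+ (con 0ℤ :+ (con 0ℤ :+ con 0ℤ))))) :- con 0ℤ
                      := r :- l) refl (coord l) (coord r))
  phases-cost {e} (phase {t = t} {S} {h} run isPhase) e∈H₀ =
    phase-cost isPhase S (waiting run) e∈H₀
      (phases-cost run (far∈H {e} {h} (IsPhase.left≤right isPhase)))

  -- Feasibility from an intermediate state, in a form fit for induction over phases: the time `u`
  -- precedes the remaining actions.
  record Serves (u : ℝ) (e : Site) (R : List Request) (S : Schedule) : Set where
    field
      ordered     : Linked _≤_ (u ∷ map time S)
      chained     : Chained e (concatMap walks S)
      contiguous  : All (λ P → Linked Step (toList P)) (concatMap walks S)
      nonePending : pending (finalFrom ⟨ e , [] , R ⟩ S) ≡ []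
      noneMissed  : All (λ q → location q ≡ position (finalFrom ⟨ e , [] , R ⟩ S))
                        (upcoming (finalFrom ⟨ e , [] , R ⟩ S))

  phases-serve : ∀ {u e H₀ R S} → Phases e H₀ R S → (∀ {q} → q ∈ R → u ≤ arrival q) → Serves u e R S
  phases-serve (idle all≡e) _ = record
    { ordered = [-] ; chained = tt ; contiguous = [] ; nonePending = refl ; noneMissed = all≡e }
  phases-serve {u} {e} {H₀} {R} (phase {q₀} {t} {S} {h} run isPhase) u≤R = record
    { ordered     = ≤.trans (u≤R started) α≤t ∷ ordered
    ; chained     = refl , subst (λ v → Chained v (concatMap walks S)) (sym (end-sweep e h)) chained
    ; contiguous  = sweep-contiguous e h ∷ contiguous
    ; nonePending = subst (λ σ → pending (finalFrom σ S) ≡ []) (sym (sweep-serves isPhase)) nonePending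
    ; noneMissed  = subst (λ σ → All (λ q → location q ≡ position (finalFrom σ S)) (upcoming (finalFrom σ S)))
                          (sym (sweep-serves isPhase)) noneMissed
    }
    where
    open IsPhase isPhase
    open Serves (phases-serve {t} run (λ q∈ → ≰⇒≥ (proj₂ (∈-after⁻ {t} {_} {R} q∈))))

  -- Offline schedules

  -- The waiting incurred by time `t` that no service event has been charged for yet, the server
  -- staying parked until `t`.
  accrued : ℝ → State → ℝ
  accrued t σ = maxDelay t (pending (arrive t σ))

  Arrived : ℝ → State → Set
  Arrived t σ = ∀ {q} → q ∈ pending σ → arrival q ≤ t

  arrive-Arrived : ∀ {c t σ} → c ≤ t → Arrived c σ → Arrived t (arrive t σ)
  arrive-Arrived {t = t} {σ} c≤t arrived q∈ with arrive⁻ {t} {_} {σ} q∈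
  ... | inj₁ q∈pending       = ≤.trans (arrived q∈pending) c≤t
  ... | inj₂ (_ , a≤t , _)   = a≤t

  arrive-mono : ∀ {c t σ q} → c ≤ t → q ∈ pending (arrive c σ) → q ∈ pending (arrive t σ)
  arrive-mono {c} {t} {σ} c≤t q∈ with arrive⁻ {c} {_} {σ} q∈
  ... | inj₁ q∈pending            = arrive-pending⁺ {t} {_} {σ} q∈pending
  ... | inj₂ (q∈up , a≤c , ≢pos)  = arrive-upcoming⁺ {t} {_} {σ} q∈up (≤.trans a≤c c≤t) ≢pos

  accrued-mono : ∀ {c t} σ → c ≤ t → accrued c σ ≤ accrued t σ
  accrued-mono {c} {t} σ c≤t = maxDelay-lub (pending (arrive c σ)) (0≤maxDelay t (pending (arrive t σ)))
    λ {q} q∈ → ≤.trans (+-monoˡ-≤ (- arrival q) c≤t) (delay≤maxDelay (arrive-mono {σ = σ} c≤t q∈))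

  -- A parked server keeps every pending request pending, and each delay grows by `t - c`. The
  -- request `q` is there because `maxDelay` is zero on the empty list and would not grow.
  accrued-grows : ∀ {c t σ q} → c ≤ t → Arrived c σ → q ∈ pending (arrive c σ) →
                  accrued c σ ≤ accrued t σ - (t - c)
  accrued-grows {c} {t} {σ} c≤t arrived q∈ = maxDelay-lub (pending (arrive c σ))
    (≤-from (+-mono-≤ (delay q∈) (arrive-Arrived {σ = σ} ≤.refl arrived q∈))
      (solve 4 (λ c t a A → (A :- (t :- c)) :- con 0ℤ := (A :+ c) :- ((t :- a) :+ a)) refl c t _ (accrued t σ)))
    λ q∈ → ≤-from (delay q∈)
      (solve 4 (λ c t a A → (A :- (t :- c)) :- (c :- a) := A :- (t :- a)) refl c t _ (accrued t σ))
    where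
    delay : ∀ {q} → q ∈ pending (arrive c σ) → t - arrival q ≤ accrued t σ
    delay q∈ = delay≤maxDelay (arrive-mono {σ = σ} c≤t q∈)

  -- Each pending request is either served by the walk or left over, so its delay is bounded by one
  -- of the two maxima.
  walk-delay : ∀ t P σ → maxDelay t (pending σ)
               ≤ maxDelay t (served P (pending σ)) + maxDelay t (pending (afterWalk P σ))
  walk-delay t P σ = maxDelay-lub (pending σ)
    (≤-from (+-mono-≤ 0≤A 0≤B) (solve 2 (λ A B → (A :+ B) :- con 0ℤ := (A :+ B) :- (con 0ℤ :+ con 0ℤ)) refl A B))
    each
    where
    A = maxDelay t (served P (pending σ))
    B = maxDelay t (pending (afterWalk P σ))
    0≤A = 0≤maxDelay t (served P (pending σ))
    0≤B = 0≤maxDelay t (pending (afterWalk P σ))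

    each : ∀ {q} → q ∈ pending σ → t - arrival q ≤ A + B
    each {q} q∈ with location q ∈? toList P
    ... | yes visited = ≤-from (+-mono-≤ (delay≤maxDelay (served⁺ {t} {q} {P} q∈ visited)) 0≤B)
      (solve 3 (λ x A B → (A :+ B) :- x := (A :+ B) :- (x :+ con 0ℤ)) refl (t - arrival q) A B)
    ... | no  missed  = ≤-from (+-mono-≤ 0≤A (delay≤maxDelay (afterWalk⁺ {t} {q} {P} {σ} q∈ missed)))
      (solve 3 (λ x A B → (A :+ B) :- x := (A :+ B) :- (con 0ℤ :+ x)) refl (t - arrival q) A B)

  walks-delay : ∀ t Ps σ → maxDelay t (pending σ)
                ≤ walksCost t Ps σ + maxDelay t (pending (afterWalks Ps σ))
  walks-delay t []       σ = ≤.reflexive (solve 1 (λ m → m := con 0ℤ :+ m) refl _)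
  walks-delay t (P@(v ∷ vs) ∷ Ps) σ =
    ≤-from (+-mono-≤ (+-mono-≤ (walk-delay t P σ) (walks-delay t Ps (afterWalk P σ))) (0≤lenFrom v vs))
      (solve 6 (λ l s m m₁ m₂ w → (((l :+ s) :+ w) :+ m₂) :- m
                               := (((s :+ m₁) :+ (w :+ m₂)) :+ l) :- ((m :+ m₁) :+ con 0ℤ)) refl
        (len P) (maxDelay t (served P (pending σ))) (maxDelay t (pending σ))
        (maxDelay t (pending (afterWalk P σ))) (maxDelay t (pending (afterWalks Ps (afterWalk P σ))))
        (walksCost t Ps (afterWalk P σ)))

  afterWalks-pending⁻ : ∀ {t q} Ps {σ} → q ∈ pending (afterWalks Ps σ) → q ∈ pending σ
  afterWalks-pending⁻     []       q∈ = q∈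
  afterWalks-pending⁻ {t} (P ∷ Ps) {σ} q∈ =
    afterWalk⁻ {t} {_} {P} {σ} (afterWalks-pending⁻ {t} Ps q∈)

  afterWalks-upcoming : ∀ Ps σ → upcoming (afterWalks Ps σ) ≡ upcoming σ
  afterWalks-upcoming []       σ = refl
  afterWalks-upcoming (P ∷ Ps) σ = afterWalks-upcoming Ps (afterWalk P σ)

  afterWalks-chained : ∀ Ps {Qs σ} → Chained (position σ) (Ps ++ Qs) →
                       Chained (position (afterWalks Ps σ)) Qs
  afterWalks-chained []       chained       = chained
  afterWalks-chained (P ∷ Ps) (_ , chained) = afterWalks-chained Ps chained

  Config : Set
  Config = State × Schedule

  advanceFrom : ℝ → State → Schedule → Config
  advanceFrom v σ []             = σ , []
  advanceFrom v σ ((Ps at t) ∷ S) with t ≤? v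
  ... | yes _ = advanceFrom v (afterWalks Ps (arrive t σ)) S
  ... | no  _ = σ , (Ps at t) ∷ S

  advance : ℝ → Config → Config
  advance v (σ , S) = advanceFrom v σ S

  -- The cost still to come when waiting is paid as it accrues: future service events charge whole
  -- delays, of which the accrued part counts as paid.
  remaining : ℝ → Config → ℝ
  remaining c (σ , S) = costFrom σ S - accrued c σ

  record Valid (c : ℝ) (κ : Config) : Set where
    σ = proj₁ κ
    S = proj₂ κ
    field
      ordered     : Linked _≤_ (c ∷ map time S)
      chained     : Chained (position σ) (concatMap walks S)
      arrived     : Arrived c σ
      nonePending : pending (finalFrom σ S) ≡ []
      noneMissed  : All (λ q → location q ≡ position (finalFrom σ S)) (upcoming (finalFrom σ S))

  Valid-step : ∀ {c σ Ps t S} → Valid c (σ , (Ps at t) ∷ S) → Valid t (afterWalks Ps (arrive t σ) , S)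
  Valid-step {c} {σ} {Ps} {t} valid = record
    { ordered     = Linked.tail ordered
    ; chained     = afterWalks-chained Ps chained
    ; arrived     = λ q∈ → arrive-Arrived {σ = σ} (Linked.head ordered) arrived (afterWalks-pending⁻ {t} Ps q∈)
    ; nonePending = nonePending
    ; noneMissed  = noneMissed
    }
    where open Valid valid hiding (σ; S)

  Valid-later : ∀ {c v σ S} → c ≤ v → Linked _≤_ (v ∷ map time S) → Valid c (σ , S) → Valid v (σ , S)
  Valid-later c≤v ordered valid = record
    { ordered     = ordered
    ; chained     = Valid.chained valid
    ; arrived     = λ q∈ → ≤.trans (Valid.arrived valid q∈) c≤v
    ; nonePending = Valid.nonePending valid
    ; noneMissed  = Valid.noneMissed valid
    }

  advance-valid : ∀ {c v σ} S → c ≤ v → Valid c (σ , S) → Valid v (advance v (σ , S))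
  advance-valid []             c≤v valid = Valid-later c≤v [-] valid
  advance-valid {v = v} ((Ps at t) ∷ S) c≤v valid with t ≤? v
  ... | yes t≤v = advance-valid S t≤v (Valid-step valid)
  ... | no  t≰v = Valid-later c≤v (≰⇒≥ t≰v ∷ Linked.tail (Valid.ordered valid)) valid

  advance-advance : ∀ {u v σ} S → u ≤ v → advance v (advance u (σ , S)) ≡ advance v (σ , S)
  advance-advance [] u≤v = refl
  advance-advance {u} {v} ((Ps at t) ∷ S) u≤v with t ≤? u
  ... | no  _   = refl
  ... | yes t≤u with t ≤? v
  ...   | yes _   = advance-advance S u≤v
  ...   | no  t≰v = contradiction (≤.trans t≤u u≤v) t≰v

  step-upcoming⁺ : ∀ {t q} Ps {σ} → q ∈ upcoming σ → ¬ arrival q ≤ t →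
                   q ∈ upcoming (afterWalks Ps (arrive t σ))
  step-upcoming⁺ {t} {q} Ps {σ} q∈ a≰t =
    subst (q ∈_) (sym (afterWalks-upcoming Ps (arrive t σ))) (∈-after⁺ {t} q∈ a≰t)

  advance-upcoming⁺ : ∀ {v q σ} S → q ∈ upcoming σ → ¬ arrival q ≤ v →
                      q ∈ upcoming (proj₁ (advance v (σ , S)))
  advance-upcoming⁺ [] q∈ a≰v = q∈
  advance-upcoming⁺ {v} {q} {σ} ((Ps at t) ∷ S) q∈ a≰v with t ≤? v
  ... | yes t≤v = advance-upcoming⁺ S (step-upcoming⁺ Ps {σ} q∈ (λ a≤t → a≰v (≤.trans a≤t t≤v))) a≰v
  ... | no  _   = q∈

  advance-upcoming⁻ : ∀ {v q σ} S → q ∈ upcoming (proj₁ (advance v (σ , S))) → q ∈ upcoming σ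
  advance-upcoming⁻ [] q∈ = q∈
  advance-upcoming⁻ {v} {q} {σ} ((Ps at t) ∷ S) q∈ with t ≤? v
  ... | yes _ = proj₁ (∈-after⁻ {t} {q} {upcoming σ} (subst (q ∈_) (afterWalks-upcoming Ps (arrive t σ))
                  (advance-upcoming⁻ S q∈)))
  ... | no  _ = q∈

  pending≤accrued : ∀ t σ → maxDelay t (pending σ) ≤ accrued t σ
  pending≤accrued t σ = maxDelay-lub (pending σ) (0≤maxDelay t (pending (arrive t σ)))
    (λ q∈ → delay≤maxDelay (arrive-pending⁺ {t} {_} {σ} q∈))

  -- Accrued waiting persists until some walk is charged for it, and a schedule that serves
  -- everything ends with none. Hence `remaining` is nonnegative.
  accrued≤cost : ∀ {c σ} S → Valid c (σ , S) → accrued c σ ≤ costFrom σ S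
  accrued≤cost {c} {σ} [] valid = maxDelay-lub (pending (arrive c σ)) ≤.refl none
    where
    none : ∀ {q} → q ∈ pending (arrive c σ) → c - arrival q ≤ 0#
    none {q} q∈ with arrive⁻ {c} {q} {σ} q∈
    ... | inj₁ q∈pending with subst (q ∈_) (Valid.nonePending valid) q∈pending
    ...   | ()
    none {q} q∈ | inj₂ (q∈up , _ , ≢pos) = contradiction (All.lookup (Valid.noneMissed valid) q∈up) ≢pos
  accrued≤cost {c} {σ} ((Ps at t) ∷ S) valid =
    ≤-from (+-mono-≤ (+-mono-≤ (accrued-mono σ (Linked.head (Valid.ordered valid)))
                              (walks-delay t Ps (arrive t σ)))
                     (≤.trans (pending≤accrued t σ′) (accrued≤cost S (Valid-step valid))))
      (solve 5 (λ a a′ w m k → (w :+ k) :- a := ((a′ :+ (w :+ m)) :+ k) :- ((a :+ a′) :+ m)) refl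
        (accrued c σ) (accrued t σ) (walksCost t Ps (arrive t σ)) (maxDelay t (pending σ′)) (costFrom σ′ S))
    where
    σ′ = afterWalks Ps (arrive t σ)

  -- What an offline server has visited

  record Explored (Y : ℝ) (Visited : Site → Set) (p : Site) : Set where
    field
      current : Visited p
      spread  : ∀ {x y} → Visited x → Visited y → coord x - coord y ≤ Y

  explored-mono : ∀ {Y Y′ Visited p} → Y ≤ Y′ → Explored Y Visited p → Explored Y′ Visited p
  explored-mono Y≤Y′ explored = record
    { current = current ; spread = λ x∈ y∈ → ≤.trans (spread x∈ y∈) Y≤Y′ }
    where open Explored explored

  explored-nonNeg : ∀ {Y Visited p} → Explored Y Visited p → 0# ≤ Y
  explored-nonNeg {p = p} explored =
    subst (_≤ _) (solve 1 (λ x → x :- x := con 0ℤ) refl (coord p)) (spread current current)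
    where open Explored explored

  -- The walk starts at a visited site, so an old and a new site are compared through that start.
  explored-walk : ∀ {Y Visited} P → Explored Y Visited (head P) →
                  Explored (Y + len P) (λ x → Visited x ⊎ x ∈ toList P) (end P)
  explored-walk {Y} {Visited} (v ∷ vs) explored = record
    { current = inj₂ (endFrom-∈ v vs) ; spread = spread′ }
    where
    open Explored explored

    detour : ∀ {x y z l} → x - z ≤ Y → z - y ≤ l → x - y ≤ Y + l
    detour {x} {y} {z} {l} x-z≤Y z-y≤l = ≤-from (+-mono-≤ x-z≤Y z-y≤l)
      (solve 5 (λ x y z l Y → (Y :+ l) :- (x :- y) := (Y :+ l) :- ((x :- z) :+ (z :- y))) refl x y z l Y)

    detour′ : ∀ {x y z l} → x - z ≤ l → z - y ≤ Y → x - y ≤ Y + l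
    detour′ {x} {y} {z} {l} x-z≤l z-y≤Y = ≤-from (+-mono-≤ x-z≤l z-y≤Y)
      (solve 5 (λ x y z l Y → (Y :+ l) :- (x :- y) := (l :+ Y) :- ((x :- z) :+ (z :- y))) refl x y z l Y)

    spread′ : ∀ {x y} → Visited x ⊎ x ∈ v ∷ vs → Visited y ⊎ y ∈ v ∷ vs →
              coord x - coord y ≤ Y + lenFrom v vs
    spread′ (inj₁ x∈) (inj₁ y∈) = ≤.trans (spread x∈ y∈) (x≤x+y (0≤lenFrom v vs))
    spread′ (inj₁ x∈) (inj₂ y∈) = detour (spread x∈ current) (spread≤lenFrom (here refl) y∈)
    spread′ (inj₂ x∈) (inj₁ y∈) = detour′ (spread≤lenFrom x∈ (here refl)) (spread current y∈)
    spread′ (inj₂ x∈) (inj₂ y∈) = ≤.trans (spread≤lenFrom x∈ y∈) (y≤x+y (explored-nonNeg explored))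

  -- v ≤ α + Y is the conclusion wanted at a trigger time v: a server that has explored Y and
  -- everything requested by time α + Y has seen a hull on which the algorithm triggers by then.
  module Window (U : List Request) (p₀ : Site) (v α : ℝ)
    (trigger : ∀ {Y Visited p} → Explored Y Visited p → Visited p₀ →
               (∀ {q} → q ∈ U → arrival q ≤ α + Y → Visited (location q)) → v ≤ α + Y)
    where

    record Invariant (c : ℝ) (σ : State) (Y : ℝ) (Visited : Site → Set) : Set where
      field
        progress : c ≤ α + Y
        origin   : Visited p₀
        explored : Explored Y Visited (position σ)
        covered  : ∀ {q} → q ∈ U → Visited (location q) ⊎ q ∈ pending σ ⊎ q ∈ upcoming σ

    -- While a request is pending, payment keeps pace with time. If none is pending at `c`, either a
    -- request arriving by `α + Y` becomes pending and its delay makes up the pause, or all of those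
    -- are visited and the trigger hypothesis gives `v ≤ α + Y`.
    wait : ∀ {c t σ Y Visited} → c ≤ t → t ≤ v → Arrived c σ → Invariant c σ Y Visited →
           Invariant t σ (Y + (accrued t σ - accrued c σ)) Visited
    wait {c} {t} {σ} {Y} {Visited} c≤t t≤v arrived inv = record
      { progress = progress′ ; origin = origin
      ; explored = explored-mono Y≤Y′ explored ; covered = covered }
      where
      open Invariant inv
      Y′ = Y + (accrued t σ - accrued c σ)

      Y≤Y′ : Y ≤ Y′
      Y≤Y′ = x≤x+y (x≤y⇒0≤y-x (accrued-mono σ c≤t))

      busy : ∀ {Y A A′} → c ≤ α + Y → A ≤ A′ - (t - c) → t ≤ α + (Y + (A′ - A))
      busy {Y} {A} {A′} c≤ A≤ = ≤-from (+-mono-≤ c≤ A≤)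
        (solve 6 (λ c t α Y A A′ → (α :+ (Y :+ (A′ :- A))) :- t
                                := ((α :+ Y) :+ (A′ :- (t :- c))) :- (c :+ A)) refl c t α Y A A′)

      late : ∀ {Y A a} → t - a ≤ A → a ≤ α + Y → t ≤ α + (Y + (A - 0#))
      late {Y} {A} {a} t-a≤ a≤ = ≤-from (+-mono-≤ t-a≤ a≤)
        (solve 5 (λ t α Y A a → (α :+ (Y :+ (A :- con 0ℤ))) :- t
                                := (A :+ (α :+ Y)) :- ((t :- a) :+ a)) refl t α Y A a)

      grown : α + Y ≤ α + Y′
      grown = +-mono-≤ ≤.refl Y≤Y′

      all-visited : [] ≡ pending (arrive c σ) → ¬ t ≤ α + Y′ →
                    ∀ {q} → q ∈ U → arrival q ≤ α + Y → Visited (location q)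
      all-visited none t≰ {q} q∈ a≤ with covered q∈
      ... | inj₁ visited          = visited
      ... | inj₂ (inj₁ q∈pending) =
        contradiction (subst (q ∈_) (sym none) (arrive-pending⁺ {c} {q} {σ} q∈pending)) λ ()
      ... | inj₂ (inj₂ q∈upcoming) with location q Fin.≟ position σ
      ...   | yes ≡pos = subst Visited (sym ≡pos) (Explored.current explored)
      -- Such a request would be pending at `t`. As it arrived by `α + Y`, its delay alone would
      -- lift the payment to at least `t - α`.
      ...   | no  ≢pos = contradiction
        (subst (λ A → t ≤ α + (Y + (accrued t σ - A))) (cong (maxDelay c) none)
          (late (delay≤maxDelay (arrive-upcoming⁺ {t} {q} {σ} q∈upcoming
            (≤.trans a≤ (≤.trans grown (≰⇒≥ t≰))) ≢pos)) a≤)) t≰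

      idle-or-busy : ∀ qs → qs ≡ pending (arrive c σ) → t ≤ α + Y′
      idle-or-busy (q ∷ _) some = busy progress
        (accrued-grows {σ = σ} c≤t arrived (subst (q ∈_) some (here refl)))
      idle-or-busy []      none = decidable-stable (t ≤? α + Y′) λ t≰ → t≰
        (≤.trans t≤v (≤.trans (trigger explored origin (all-visited none t≰)) grown))

      progress′ : t ≤ α + Y′
      progress′ = idle-or-busy (pending (arrive c σ)) refl

    arrival-step : ∀ {t σ Y Visited} → Invariant t σ Y Visited → Invariant t (arrive t σ) Y Visited
    arrival-step {t} {σ} {Visited = Visited} inv = record
      { progress = progress ; origin = origin ; explored = explored ; covered = covered′ }
      where
      open Invariant inv

      covered′ : ∀ {q} → q ∈ U →
                 Visited (location q) ⊎ q ∈ pending (arrive t σ) ⊎ q ∈ upcoming (arrive t σ)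
      covered′ {q} q∈ with covered q∈
      ... | inj₁ visited          = inj₁ visited
      ... | inj₂ (inj₁ q∈pending) = inj₂ (inj₁ (arrive-pending⁺ {t} {q} {σ} q∈pending))
      ... | inj₂ (inj₂ q∈upcoming) with arrival q ≤? t | location q Fin.≟ position σ
      ...   | no  a≰t | _        = inj₂ (inj₂ (∈-after⁺ {t} q∈upcoming a≰t))
      ...   | yes a≤t | yes ≡pos = inj₁ (subst Visited (sym ≡pos) (Explored.current explored))
      ...   | yes a≤t | no  ≢pos = inj₂ (inj₁ (arrive-upcoming⁺ {t} {q} {σ} q∈upcoming a≤t ≢pos))

    walk-step : ∀ {t σ Y Visited} P → head P ≡ position σ → Invariant t σ Y Visited →
                Invariant t (afterWalk P σ)
                  (Y + ((walkCost t P σ + maxDelay t (pending (afterWalk P σ))) - maxDelay t (pending σ)))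
                  (λ x → Visited x ⊎ x ∈ toList P)
    walk-step {t} {σ} {Y} {Visited} P@(v ∷ vs) refl inv = record
      { progress = ≤.trans progress (+-mono-≤ ≤.refl (≤.trans (x≤x+y (0≤lenFrom v vs)) Y+len≤))
      ; origin   = inj₁ origin
      ; explored = explored-mono Y+len≤ (explored-walk P explored)
      ; covered  = covered′
      }
      where
      open Invariant inv

      -- By `walk-delay` the delay charged to the walk covers the drop in accrued waiting, so the
      -- payment grows by at least the length walked.
      gain : ∀ {Y l s m m′} → m ≤ s + m′ → Y + l ≤ Y + (((l + s) + m′) - m)
      gain {Y} {l} {s} {m} {m′} m≤ = ≤-from m≤
        (solve 5 (λ Y l s m m′ → (Y :+ (((l :+ s) :+ m′) :- m)) :- (Y :+ l) := (s :+ m′) :- m) refl Y l s m m′)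

      Y+len≤ = gain {Y} {len P} (walk-delay t P σ)

      covered′ : ∀ {q} → q ∈ U →
                 (Visited (location q) ⊎ location q ∈ toList P)
                 ⊎ q ∈ pending (afterWalk P σ) ⊎ q ∈ upcoming (afterWalk P σ)
      covered′ {q} q∈ with covered q∈
      ... | inj₁ visited           = inj₁ (inj₁ visited)
      ... | inj₂ (inj₂ q∈upcoming) = inj₂ (inj₂ q∈upcoming)
      ... | inj₂ (inj₁ q∈pending) with location q ∈? toList P
      ...   | yes on-walk  = inj₁ (inj₂ on-walk)
      ...   | no  off-walk = inj₂ (inj₁ (afterWalk⁺ {t} {q} {P} {σ} q∈pending off-walk))

    walks-step : ∀ {t σ Y Visited} Ps {Qs} → Chained (position σ) (Ps ++ Qs) → Invariant t σ Y Visited →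
                 ∃ (Invariant t (afterWalks Ps σ)
                     (Y + ((walksCost t Ps σ + maxDelay t (pending (afterWalks Ps σ))) - maxDelay t (pending σ))))
    walks-step {t} {σ} {Y} {Visited} [] _ inv = Visited , subst (λ Y → Invariant t σ Y Visited) (unchanged Y _) inv
      where
      unchanged : ∀ Y m → Y ≡ Y + ((0# + m) - m)
      unchanged = solve 2 (λ Y m → Y := Y :+ ((con 0ℤ :+ m) :- m)) refl
    walks-step {t} {σ} {Y} (P ∷ Ps) (head≡ , chained) inv =
      let Visited′ , inv′ = walks-step Ps chained (walk-step P head≡ inv)
      in Visited′ , subst (λ Y → Invariant t (afterWalks (P ∷ Ps) σ) Y Visited′) (telescope Y _ _ _ _ _) inv′
      where
      telescope : ∀ Y m m₁ m₂ w ws → (Y + ((w + m₁) - m)) + ((ws + m₂) - m₁) ≡ Y + (((w + ws) + m₂) - m)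
      telescope = solve 6 (λ Y m m₁ m₂ w ws → (Y :+ ((w :+ m₁) :- m)) :+ ((ws :+ m₂) :- m₁)
                                            := Y :+ (((w :+ ws) :+ m₂) :- m)) refl

    window-end : ∀ {c σ Y Visited} k → c ≤ v → Arrived c σ → Invariant c σ Y Visited →
                 (v - α) + (k - accrued v σ) ≤ Y + (k - accrued c σ)
    window-end {σ = σ} k c≤v arrived inv = rearrange (Invariant.progress (wait c≤v ≤.refl arrived inv))
      where
      rearrange : ∀ {Y a a′} → v ≤ α + (Y + (a′ - a)) → (v - α) + (k - a′) ≤ Y + (k - a)
      rearrange {Y} {a} {a′} v≤ = ≤-from v≤
        (solve 6 (λ v α Y a a′ k → (Y :+ (k :- a)) :- ((v :- α) :+ (k :- a′))
                                := (α :+ (Y :+ (a′ :- a))) :- v) refl v α Y a a′ k)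

    -- `Y` never grows by more than `remaining` drops, and at time `v` the invariant says that `Y`
    -- has reached `v - α`.
    window : ∀ {c σ Y Visited} S → c ≤ v → Valid c (σ , S) → Invariant c σ Y Visited →
             (v - α) + remaining v (advance v (σ , S)) ≤ Y + remaining c (σ , S)
    window [] c≤v valid inv = window-end 0# c≤v (Valid.arrived valid) inv
    window {c} {σ} {Y} ((Ps at t) ∷ S) c≤v valid inv with t ≤? v
    ... | no  t≰v = window-end (costFrom σ ((Ps at t) ∷ S)) c≤v (Valid.arrived valid) inv
    ... | yes t≤v =
      let inv′ = arrival-step (wait (Linked.head (Valid.ordered valid)) t≤v (Valid.arrived valid) inv)
          _ , inv″ = walks-step Ps (Valid.chained valid) inv′
      in combine (window S t≤v (Valid-step valid) inv″) (pending≤accrued t (afterWalks Ps (arrive t σ)))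
      where
      combine : ∀ {T Y a A w m A′ k} → T ≤ ((Y + (A - a)) + ((w + m) - A)) + (k - A′) → m ≤ A′ →
                T ≤ Y + ((w + k) - a)
      combine {T} {Y} {a} {A} {w} {m} {A′} {k} T≤ m≤A′ = ≤-from (+-mono-≤ T≤ m≤A′)
        (solve 8 (λ T Y a A w m A′ k → (Y :+ ((w :+ k) :- a)) :- T
             := ((((Y :+ (A :- a)) :+ ((w :+ m) :- A)) :+ (k :- A′)) :+ A′) :- (T :+ m)) refl T Y a A w m A′ k)

  -- The competitive ratio

  -- The left side is the largest of `r - l`, `r - r₀` and `l₀ - l`, each a difference of two
  -- visited coordinates.
  diam+dist≤ : ∀ {Y} {Visited : Site → Set} H₀ H →
               (∀ {x y} → Visited x → Visited y → coord x - coord y ≤ Y) →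
               Visited (left H₀) → Visited (right H₀) → Visited (left H) → Visited (right H) →
               diam H + dist H₀ H ≤ Y
  diam+dist≤ {Y} [ l₀ , r₀ ]ᴵ [ l , r ]ᴵ spread l₀∈ r₀∈ l∈ r∈ = ≤-⇒+≤ (⊔-lub (⊔-lub
    (+≤⇒≤- (≤.trans (≤.reflexive (solve 1 (λ x → x :+ con 0ℤ := x) refl _)) (spread r∈ l∈)))
    (+≤⇒≤- (≤.trans (≤.reflexive (solve 3 (λ l r r₀ → (r :- l) :+ (l :- r₀) := r :- r₀) refl
      (coord l) (coord r) (coord r₀))) (spread r∈ r₀∈))))
    (+≤⇒≤- (≤.trans (≤.reflexive (solve 3 (λ l r l₀ → (r :- l) :+ (l₀ :- r) := l₀ :- l) refl
      (coord l) (coord r) (coord l₀))) (spread l₀∈ l∈))))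

  -- The first alternative is for the initial hull at `s₀`, which nobody requested; endpoints of
  -- later hulls fall under the second.
  Known : State → ℝ → Site → Set
  Known σ u z = z ≡ position σ ⊎ ∃ λ q → q ∈ upcoming σ × arrival q ≤ u × location q ≡ z

  -- κ₁ and κ₂ are the offline configurations after the previous phase and the one before it: the
  -- windows between them overlap twice, and each pays for the waiting of one phase.
  waiting≤ : ∀ {e H₀ R S u₁ u₂ κ₁ κ₂} (run : Phases e H₀ R S) →
             u₂ ≤ u₁ → Valid u₁ κ₁ → Valid u₂ κ₂ →
             (∀ {w} → u₁ ≤ w → advance w κ₁ ≡ advance w κ₂) →
             (∀ {q} → q ∈ upcoming (proj₁ κ₁) → q ∈ upcoming (proj₁ κ₂)) →
             Known (proj₁ κ₂) u₁ (left H₀) → Known (proj₁ κ₂) u₁ (right H₀) →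
             (∀ {q} → q ∈ R → q ∈ upcoming (proj₁ κ₁) × ¬ arrival q ≤ u₁) →
             waiting run ≤ remaining u₂ κ₂ + remaining u₁ κ₁
  waiting≤ {κ₁ = _ , S₁} {_ , S₂} (idle _) _ valid₁ valid₂ _ _ _ _ _ =
    ≤.trans (x≤y⇒0≤y-x (accrued≤cost S₂ valid₂)) (x≤x+y (x≤y⇒0≤y-x (accrued≤cost S₁ valid₁)))
  waiting≤ {H₀ = H₀} {R} {u₁ = u₁} {u₂} {κ₁@(σ₁ , S₁)} {κ₂@(σ₂ , S₂)} (phase {q₀} {t} {S} {h} run isPhase)
    u₂≤u₁ valid₁ valid₂ same κ₁⊆κ₂ left-known right-known R⊆κ₁ = combine
      -- The window of this phase opens at the older configuration `κ₂`. For the next phase `κ₁`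
      -- takes that place and `κ₁` advanced to `t` becomes the newer one. It agrees with `κ₂`
      -- advanced to `t`, so its remaining cost cancels.
      (window S₂ (≤.trans u₂≤u₁ u₁≤t) valid₂ initial-invariant)
      (waiting≤ run u₁≤t (advance-valid S₁ u₁≤t valid₁) valid₁
        (λ t≤w → advance-advance S₁ t≤w) (advance-upcoming⁻ S₁)
        (known (proj₁ endpoints)) (known (proj₂ endpoints))
        λ q∈ → let q∈R , a≰t = ∈-after⁻ {t} {_} {R} q∈
               in advance-upcoming⁺ S₁ (proj₁ (R⊆κ₁ q∈R)) a≰t , a≰t)
    where
    open IsPhase isPhase

    u₁≤α : u₁ ≤ α
    u₁≤α = ≰⇒≥ (proj₂ (R⊆κ₁ started))

    u₁≤t : u₁ ≤ t
    u₁≤t = ≤.trans u₁≤α α≤t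

    known : ∀ {z} → Requested R t z → Known σ₁ t z
    known (q , q∈R , a≤t , ≡z) = inj₂ (q , proj₁ (R⊆κ₁ q∈R) , a≤t , ≡z)

    trigger : ∀ {Y Visited p} → Explored Y Visited p → Visited (position σ₂) →
              (∀ {q} → q ∈ upcoming σ₂ → arrival q ≤ α + Y → Visited (location q)) → t ≤ α + Y
    trigger {Y} {Visited} explored origin visits =
      -- At time `α + Y` the endpoints of the hull so far are visited. So are those of `H₀`, each
      -- being the origin or requested by `u₁ ≤ α`. The trigger bound is then at most `Y`, the time
      -- elapsed since `α`.
      let h′ , _ , l , r , t≤ = earliest α≤α+Y
      in t≤ (subst (diam h′ + dist H₀ h′ ≤_) (sym (cancel α Y))
           (diam+dist≤ H₀ h′ (Explored.spread explored)
             (known-visited left-known) (known-visited right-known) (requested-visited l) (requested-visited r)))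
      where
      α≤α+Y : α ≤ α + Y
      α≤α+Y = x≤x+y (explored-nonNeg explored)

      cancel : ∀ α Y → (α + Y) - α ≡ Y
      cancel = solve 2 (λ α Y → (α :+ Y) :- α := Y) refl

      known-visited : ∀ {z} → Known σ₂ u₁ z → Visited z
      known-visited (inj₁ refl)                   = origin
      known-visited (inj₂ (q , q∈ , a≤u₁ , refl)) = visits q∈ (≤.trans a≤u₁ (≤.trans u₁≤α α≤α+Y))

      requested-visited : ∀ {z} → Requested R (α + Y) z → Visited z
      requested-visited (q , q∈R , a≤ , refl) = visits (κ₁⊆κ₂ (proj₁ (R⊆κ₁ q∈R))) a≤

    open Window (upcoming σ₂) (position σ₂) t α trigger

    initial-invariant : Invariant u₂ σ₂ 0# (_≡ position σ₂)
    initial-invariant = record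
      { progress = ≤.trans (≤.trans u₂≤u₁ u₁≤α) (x≤x+y ≤.refl)
      ; origin   = refl
      ; explored = record { current = refl ; spread = λ { refl refl →
          ≤.reflexive (solve 1 (λ x → x :- x := con 0ℤ) refl (coord (position σ₂))) } }
      ; covered  = inj₂ ∘ inj₂
      }

    combine : (t - α) + remaining t (advance t κ₂) ≤ 0# + remaining u₂ κ₂ →
              waiting run ≤ remaining u₁ κ₁ + remaining t (advance t κ₁) →
              (t - α) + waiting run ≤ remaining u₂ κ₂ + remaining u₁ κ₁
    combine this rest = telescope this
      (subst (λ κ → waiting run ≤ remaining u₁ κ₁ + remaining t κ) (same u₁≤t) rest)
      where
      telescope : ∀ {T w r r₁ r₂} → T + r ≤ 0# + r₂ → w ≤ r₁ + r → T + w ≤ r₂ + r₁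
      telescope {T} {w} {r} {r₁} {r₂} T≤ w≤ = ≤-from (+-mono-≤ T≤ w≤)
        (solve 5 (λ T w r r₁ r₂ → (r₂ :+ r₁) :- (T :+ w) := ((con 0ℤ :+ r₂) :+ (r₁ :+ r)) :- ((T :+ r) :+ w))
          refl T w r r₁ r₂)

  -- Timestamps of a schedule may be negative. The first two windows need a start no later than any
  -- action and, arrivals being nonnegative, before every arrival.
  earlier : ∀ S → Linked _≤_ (map time S) → ∃ λ c → Linked _≤_ (c ∷ map time S) × c < 0#
  earlier [] _ = - 1# , [-] , -1<0
  earlier ((Ps at t) ∷ S) ordered with t ≤? - 1#
  ... | yes t≤-1 = t , ≤.refl ∷ ordered , ≤-<-trans t≤-1 -1<0
  ... | no  t≰-1 = - 1# , ≰⇒≥ t≰-1 ∷ ordered , -1<0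

  feasible-valid : ∀ {s₀ I c} S → Feasible s₀ I S → Linked _≤_ (c ∷ map time S) → Valid c (initial s₀ I , S)
  feasible-valid S feasible ordered = record
    { ordered = ordered ; chained = chained ; arrived = λ ()
    ; nonePending = nonePending ; noneMissed = noneMissed }
    where open Feasible feasible hiding (ordered)

  module _ (s₀ : Site) (I : Input) where

    0≤feasibleCost : ∀ S → Feasible s₀ I S → 0# ≤ cost s₀ I S
    0≤feasibleCost S feasible =
      let c , ordered , _ = earlier S (Feasible.ordered feasible)
      in ≤.trans (0≤maxDelay c (pending (arrive c (initial s₀ I))))
                 (accrued≤cost S (feasible-valid S feasible ordered))

    waiting≤2cost : ∀ {S} (run : Phases s₀ [ s₀ , s₀ ]ᴵ I S) S′ → Feasible s₀ I S′ →
                    waiting run ≤ cost s₀ I S′ + cost s₀ I S′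
    waiting≤2cost run S′ feasible =
      let c , ordered , c<0 = earlier S′ (Feasible.ordered feasible)
          valid = feasible-valid S′ feasible ordered
          remaining≤cost = x-y≤x (0≤maxDelay c (pending (arrive c (initial s₀ I))))
      in ≤.trans (waiting≤ run ≤.refl valid valid (λ _ → refl) id (inj₁ refl) (inj₁ refl)
                   (λ {q} q∈ → q∈ , λ a≤c → <⇒≱ c<0 (≤.trans (arrival≥0 q) a≤c)))
                 (+-mono-≤ remaining≤cost remaining≤cost)

    run-feasible : ∀ {S} → GlobalHullRun s₀ I S → Feasible s₀ I S
    run-feasible run = record
      { ordered = Linked.tail ordered ; chained = chained ; contiguous = contiguous
      ; nonePending = nonePending ; noneMissed = noneMissed }
      where open Serves (phases-serve {0#} (phases run) (λ {q} _ → arrival≥0 q))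

    competitive : ∀ {S} → GlobalHullRun s₀ I S → ∀ S′ → Feasible s₀ I S′ →
                  cost s₀ I S ≤ 10 · cost s₀ I S′
    competitive run S′ feasible = combine
      (phases-cost (phases run) (ℕ.≤-refl , ℕ.≤-refl)) (waiting≤2cost (phases run) S′ feasible)
      (0≤feasibleCost S′ feasible)
      where
      combine : ∀ {x c w f} → c ≤ (x - x) + 4 · w → w ≤ f + f → 0# ≤ f → c ≤ 10 · f
      combine {x} {c} {w} {f} c≤ w≤ 0≤f = ≤-from
        -- Four uses of `w ≤ f + f` give the factor 8, and the two uses of `0≤f` pad it to 10;
        -- `x - x` is the diameter of the initial hull.
        (+-mono-≤ (+-mono-≤ c≤ (+-mono-≤ 0≤f 0≤f)) (+-mono-≤ (+-mono-≤ w≤ w≤) (+-mono-≤ w≤ w≤)))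
        (solve 4 (λ x c w f →
            (f :+ (f :+ (f :+ (f :+ (f :+ (f :+ (f :+ (f :+ (f :+ (f :+ con 0ℤ)))))))))) :- c
         := (((((x :- x) :+ (w :+ (w :+ (w :+ (w :+ con 0ℤ))))) :+ (f :+ f))
              :+ (((f :+ f) :+ (f :+ f)) :+ ((f :+ f) :+ (f :+ f))))
             :- ((c :+ (con 0ℤ :+ con 0ℤ)) :+ ((w :+ w) :+ (w :+ w))))) refl x c w f)

corollary4p4 : (𝓡 : Reals) (X : FiniteSubset 𝓡) →
    let open Service 𝓡 X in
    (s₀ : Site) (I : Input) →
    ∃ λ (OPT : ℝ) → IsOPT s₀ I OPT
    × (∃ λ S → GlobalHullRun s₀ I S)
    × (∀ S → GlobalHullRun s₀ I S → Feasible s₀ I S × cost s₀ I S ≤ 10 · OPT)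
corollary4p4 𝓡 X s₀ I =
  let S , run = run-exists _ s₀ [ s₀ , s₀ ]ᴵ I ℕ.≤-refl
      -- The run itself witnesses that a feasible schedule exists, and costs are bounded below by
      -- zero.
      OPT , isOPT = complete (FeasibleCost s₀ I)
        (cost s₀ I S , S , run-feasible s₀ I run , refl)
        (0# , λ { _ (S , feasible , refl) → 0≤feasibleCost s₀ I S feasible })
  in OPT , isOPT , (S , run) , λ S run → run-feasible s₀ I run ,
     infimum-scale 9 isOPT (λ { _ (S′ , feasible , refl) → competitive s₀ I run S′ feasible })
  where
  open Service 𝓡 X
  open OrderedField 𝓡
  open Competitiveness 𝓡 X
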